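{- For all integers $d\geq 2$ and $q\geq 2$, every ordered $d$-degenerate graph $H^<$ on $n\geq 3$ vertices with at least one edge and with interval chromatic number $\chi$ satisfies \[ r_<(H^<;q)\leq n^{60d^{q-1}\lceil\log\chi\rceil^{q-1}}. \]
   Context: Logarithms are to base two. An ordered graph $G^<$ is a finite graph together with a linear order on its vertex set. An ordered copy of $H^<$ in $G^<$ is given by an increasing injection $f\colon V(H)\to V(G)$ with $f(u)f(v)\in E(G)$ whenever $uv\in E(H)$. The interval chromatic number of $G^<$ is the minimum number of intervals (of the vertex order) into which $V(G)$ can be partitioned so that no two vertices in the same interval are adjacent. A graph is $d$-degenerate if each of its nonempty subgraphs has a vertex of degree at most $d$. $K_N^<$ is the ordered complete graph on $N$ vertices. The ordered Ramsey number $r_<(H^<;q)$ is the smallest $N$ such that every coloring of the edges of $K_N^<$ with $q$ colors contains a monochromatic ordered copy of $H^<$. -}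

module Defs where

open import Level using (0ℓ)
open import Data.Nat.Base using (ℕ; _≤_)
open import Data.Fin.Base using (Fin) renaming (_<_ to _<ᶠ_; _≤_ to _≤ᶠ_)
open import Data.Fin.Properties using () renaming (_≟_ to _≟ᶠ_)
open import Data.Fin.Subset using (Subset; _∈_; Nonempty; ∣_∣)
open import Data.Product.Base using (∃-syntax; _×_; _,_; map)
open import Data.Vec.Base using (tabulate)
open import Function.Definitions using (StrictlySurjective)
open import Relation.Binary.Core using (Rel; _Preserves_⟶_; _⇒_)
open import Relation.Binary.Definitions using (Symmetric; Irreflexive; Decidable)
open import Relation.Binary.PropositionalEquality using (_≡_; _≢_; trans; ≢-sym)
open import Relation.Nullary.Decidable using (does; ¬?; _×-dec_)

IsLeast : (ℕ → Set) → ℕ → Set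
IsLeast P k = P k × (∀ m → P m → k ≤ m)

-- A simple graph with n linearly ordered vertices: the vertices are numbered
-- in increasing order, so the vertex order is the usual order on Fin n.
record OrderedGraph (n : ℕ) : Set₁ where
  field
    Adj    : Rel (Fin n) 0ℓ
    symm   : Symmetric Adj
    irrefl : Irreflexive _≡_ Adj
    adj?   : Decidable Adj

open OrderedGraph public

HasEdge : ∀ {n} → OrderedGraph n → Set
HasEdge G = ∃[ u ] ∃[ v ] Adj G u v

degree : ∀ {n} → OrderedGraph n → Fin n → ℕ
degree G v = ∣ tabulate (λ w → does (adj? G v w)) ∣

-- The subgraph of G with vertex set S and with the edges of F; vertices
-- outside S are isolated in F.
record IsSubgraph {n} (S : Subset n) (F G : OrderedGraph n) : Set where
  field
    edges     : Adj F ⇒ Adj G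
    endpoints : ∀ {u v} → Adj F u v → u ∈ S

Degenerate : ∀ {n} → ℕ → OrderedGraph n → Set₁
Degenerate {n} d G =
  ∀ (S : Subset n) (F : OrderedGraph n) → IsSubgraph S F G → Nonempty S →
  ∃[ v ] (v ∈ S × degree F v ≤ d)

-- A partition into k nonempty intervals is given by the map sending each
-- vertex to the index of its part; the indices need not respect the order.
record IntervalColouring {n} (G : OrderedGraph n) (k : ℕ) : Set where
  field
    part        : Fin n → Fin k
    nonempty    : StrictlySurjective _≡_ part
    interval    : ∀ {u v w} → u ≤ᶠ v → v ≤ᶠ w → part u ≡ part w → part v ≡ part u
    independent : ∀ {u v} → Adj G u v → part u ≢ part v

IsIntervalChromaticNumber : ∀ {n} → OrderedGraph n → ℕ → Set
IsIntervalChromaticNumber G = IsLeast (IntervalColouring G)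

-- Injectivity of the embedding follows from it being strictly increasing.
record OrderedCopy {m n} (H : OrderedGraph m) (G : OrderedGraph n) : Set where
  field
    embed      : Fin m → Fin n
    increasing : embed Preserves _<ᶠ_ ⟶ _<ᶠ_
    edges      : embed Preserves Adj H ⟶ Adj G

K< : ∀ N → OrderedGraph N
K< N = record
  { Adj    = _≢_
  ; symm   = ≢-sym
  ; irrefl = λ u≡v u≢v → u≢v u≡v
  ; adj?   = λ u v → ¬? (u ≟ᶠ v)
  }

-- A colouring of the edges of a graph on N vertices. The values at
-- pairs that are not edges are never used.
record EdgeColouring (N q : ℕ) : Set where
  field
    colour      : Fin N → Fin N → Fin q
    colour-symm : ∀ u v → colour u v ≡ colour v u

colourClass : ∀ {N q} → OrderedGraph N → EdgeColouring N q → Fin q → OrderedGraph N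
colourClass G κ c = record
  { Adj    = λ u v → Adj G u v × colour u v ≡ c
  ; symm   = λ {u} {v} → map (symm G) (trans (colour-symm v u))
  ; irrefl = λ { u≡v (uv , _) → irrefl G u≡v uv }
  ; adj?   = λ u v → adj? G u v ×-dec (colour u v ≟ᶠ c)
  }
  where open EdgeColouring κ

Arrows : ∀ {n} → OrderedGraph n → ℕ → ℕ → Set
Arrows H q N =
  ∀ (κ : EdgeColouring N q) → ∃[ c ] OrderedCopy H (colourClass (K< N) κ c)

IsOrderedRamseyNumber : ∀ {n} → OrderedGraph n → ℕ → ℕ → Set
IsOrderedRamseyNumber H q = IsLeast (Arrows H q)

module Submission where

-- Colours are removed one at a time.  With R j the set of edges of colour less than j, suppose that
-- every large vertex set contains 2^L ≥ χ consecutive large sets that are pairwise sparse in R j.  Try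
-- to embed H into them in colour j, greedily along a degeneracy order, the candidate set of a vertex
-- shrinking by at most a factor T for each embedded neighbour.  The attempt can only fail because of
-- two sets X, Y that are sparse in colour j as well.  Since Y has lost at most d − 1 factors of T,
-- X and Y stay sparse in R (j + 1) if the initial sparseness was about T^d.  Splitting X and Y again,
-- L times in all, yields 2^L sets pairwise sparse in R (j + 1).  So the exponent of the required size
-- is multiplied by L at each step while that of the required sparseness is multiplied by d.  When
-- all but the last colour have been dealt with, sparse sets of size n have no edges of old colours
-- between them and H embeds in the last colour.

open import Algebra.Properties.CommutativeSemigroup using (x∙yz≈y∙xz)
open import Data.Bool using (true; false; if_then_else_)
open import Data.Empty using (⊥; ⊥-elim)
open import Data.Fin using (Fin; toℕ; finToFun; funToFin)
import Data.Fin as F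
import Data.Fin.Properties as F
open import Data.Fin.Subset using (Subset; ∣_∣; ⊤; inside; outside)
  renaming (_∈_ to _∈ₛ_; _∉_ to _∉ₛ_; _-_ to _∖_)
open import Data.Fin.Subset.Properties
  using (nonempty?; ∈⊤; ∣⊤∣≡n; p⊂q⇒∣p∣<∣q∣; p⊆q⇒∣p∣≤∣q∣; p─q⊆p; x∈p∧x≢y⇒x∈p-y; x∈p⇒∣p-x∣<∣p∣)
  renaming (_∈?_ to _∈ₛ?_)
open import Data.List
  using (List; []; _∷_; _++_; length; map; filter; take; drop; concatMap; upTo; allFin)
open import Data.List.Membership.Propositional using (_∈_; find; lose)
open import Data.List.Membership.Propositional.Properties
  using (∈-filter⁺; ∈-filter⁻; ∈-++⁻; ∈-++⁺ˡ; ∈-++⁺ʳ; ∈-upTo⁺; ∈-upTo⁻)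
open import Data.List.Properties
  using (length-take; length-drop; length-++; length-filter; length-upTo; length-tabulate; map-++;
         filter-≐; filter-some; filter-none)
open import Data.List.Relation.Binary.Sublist.Propositional
  using (_⊆_; []; _∷_; _∷ʳ_; ⊆-refl; ⊆-trans; lookup)
open import Data.List.Relation.Binary.Sublist.Propositional.Properties
  using (All-resp-⊆; length-mono-≤; take-⊆; drop-⊆; filter-⊆; ++⁺ˡ; ++⁺ʳ)
  renaming (filter⁺ to ⊆-filter⁺; drop⁺ to ⊆-drop⁺)
open import Data.List.Relation.Unary.All using ([]; _∷_)
import Data.List.Relation.Unary.All as All
open import Data.List.Relation.Unary.AllPairs using (AllPairs; []; _∷_)
import Data.List.Relation.Unary.AllPairs.Properties as AllPairs
open import Data.List.Relation.Unary.Any using (Any; here; there; any?)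
open import Data.List.Relation.Unary.Unique.Propositional using (Unique)
import Data.List.Relation.Unary.Unique.Propositional.Properties as Unique
open import Data.Nat
  using (ℕ; zero; suc; pred; _+_; _*_; _^_; _∸_; _⊓_; _≤_; _<_; z≤n; s≤s; _≤?_; _<?_;
         ⌈_/2⌉; ⌊_/2⌋; >-nonZero)
import Data.Nat as ℕ
open import Data.Nat.Induction using (<-rec)
open import Data.Nat.ListAction using (sum)
open import Data.Nat.ListAction.Properties using (sum-++)
open import Data.Nat.Logarithm using (⌈log₂_⌉; ⌈log₂⌉-mono-≤; ⌈log₂⌈n/2⌉⌉≡⌈log₂n⌉∸1)
open import Data.Nat.Properties
open import Data.Nat.Solver using (module +-*-Solver)
open import Data.Product using (∃-syntax; _×_; _,_; proj₁; proj₂)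
open import Data.Sum using (_⊎_; inj₁; inj₂)
import Data.Sum as Sum
open import Data.Vec using (tabulate; []; _∷_; here; there)
open import Data.Vec.Properties using (lookup∘tabulate; []=⇒lookup; lookup⇒[]=)
open import Function using (_∘_; _$_; flip)
open import Level using (0ℓ)
import Relation.Binary as B
open import Relation.Binary.PropositionalEquality
open import Relation.Nullary using (¬_; Dec; yes; no; does; contradiction)
open import Relation.Nullary.Decidable
  using (_×-dec_; _→-dec_; ¬?; map′; dec-true; dec-false; decidable-stable)
open import Relation.Unary using (Pred; Decidable)
open import Defs

private variable
  A A′ : Set

-- Counting in lists

∑ : List A → (A → ℕ) → ℕ
∑ xs f = sum (map f xs)

count : {P : Pred A 0ℓ} → Decidable P → List A → ℕ
count P? xs = length (filter P? xs)

indicator : {P : Set} → Dec P → ℕ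
indicator P? = if does P? then 1 else 0

count-∷ : {P : Pred A 0ℓ} (P? : Decidable P) (x : A) (xs : List A) →
          count P? (x ∷ xs) ≡ indicator (P? x) + count P? xs
count-∷ P? x xs with does (P? x)
... | true  = refl
... | false = refl

count-⊆ : {P : Pred A 0ℓ} (P? : Decidable P) {xs ys : List A} →
          xs ⊆ ys → count P? xs ≤ count P? ys
count-⊆ P? xs⊆ys = length-mono-≤ (⊆-filter⁺ P? P? (λ { refl p → p }) xs⊆ys)

count-split : {P Q : Pred A 0ℓ} (P? : Decidable P) (Q? : Decidable Q) →
              (∀ x → ¬ P x → Q x) → ∀ xs → length xs ≤ count P? xs + count Q? xs
count-split P? Q? cover [] = z≤n
count-split P? Q? cover (x ∷ xs) with P? x | Q? x | count-split P? Q? cover xs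
... | yes _ | yes _ | ih = s≤s (≤-trans ih (+-monoʳ-≤ (count P? xs) (n≤1+n _)))
... | yes _ | no _  | ih = s≤s ih
... | no _  | yes _ | ih = ≤-trans (s≤s ih) (≤-reflexive (sym (+-suc (count P? xs) _)))
... | no ¬p | no ¬q | ih = contradiction (cover x ¬p) ¬q

count-⊎ : {P Q R : Pred A 0ℓ} (P? : Decidable P) (Q? : Decidable Q) (R? : Decidable R) →
          (∀ x → R x → P x ⊎ Q x) → ∀ xs → count R? xs ≤ count P? xs + count Q? xs
count-⊎ P? Q? R? cover [] = z≤n
count-⊎ P? Q? R? cover (x ∷ xs) with P? x | Q? x | R? x | count-⊎ P? Q? R? cover xs
... | yes _ | yes _ | yes _ | ih = s≤s (≤-trans ih (+-monoʳ-≤ (count P? xs) (n≤1+n _)))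
... | yes _ | no _  | yes _ | ih = s≤s ih
... | no _  | yes _ | yes _ | ih = ≤-trans (s≤s ih) (≤-reflexive (sym (+-suc (count P? xs) _)))
... | no ¬p | no ¬q | yes r | ih with cover x r
...   | inj₁ p = contradiction p ¬p
...   | inj₂ q = contradiction q ¬q
count-⊎ P? Q? R? cover (x ∷ xs) | yes _ | yes _ | no _ | ih =
  ≤-trans ih (+-mono-≤ (n≤1+n (count P? xs)) (n≤1+n _))
count-⊎ P? Q? R? cover (x ∷ xs) | yes _ | no _ | no _ | ih = m≤n⇒m≤1+n ih
count-⊎ P? Q? R? cover (x ∷ xs) | no _ | yes _ | no _ | ih =
  ≤-trans ih (+-monoʳ-≤ (count P? xs) (n≤1+n _))
count-⊎ P? Q? R? cover (x ∷ xs) | no _ | no _ | no _ | ih = ih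

∑-++ : (f : A → ℕ) (xs ys : List A) → ∑ (xs ++ ys) f ≡ ∑ xs f + ∑ ys f
∑-++ f xs ys = trans (cong sum (map-++ f xs ys)) (sum-++ (map f xs) _)

∑-+ : (f g : A → ℕ) (xs : List A) → ∑ xs (λ x → f x + g x) ≡ ∑ xs f + ∑ xs g
∑-+ f g [] = refl
∑-+ f g (x ∷ xs) = begin
  f x + g x + ∑ xs (λ y → f y + g y)  ≡⟨ cong (f x + g x +_) (∑-+ f g xs) ⟩
  f x + g x + (∑ xs f + ∑ xs g)       ≡⟨ +-assoc (f x) _ _ ⟩
  f x + (g x + (∑ xs f + ∑ xs g))
    ≡⟨ cong (f x +_) (x∙yz≈y∙xz +-commutativeSemigroup (g x) (∑ xs f) (∑ xs g)) ⟩
  f x + (∑ xs f + (g x + ∑ xs g))     ≡⟨ +-assoc (f x) _ _ ⟨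
  f x + ∑ xs f + (g x + ∑ xs g)       ∎
  where open ≡-Reasoning

∑-cong : {f g : A → ℕ} → (∀ x → f x ≡ g x) → (xs : List A) → ∑ xs f ≡ ∑ xs g
∑-cong f≗g []       = refl
∑-cong f≗g (x ∷ xs) = cong₂ _+_ (f≗g x) (∑-cong f≗g xs)

∑-0 : (xs : List A) → ∑ xs (λ _ → 0) ≡ 0
∑-0 []       = refl
∑-0 (_ ∷ xs) = ∑-0 xs

count≡∑ : {P : Pred A 0ℓ} (P? : Decidable P) (xs : List A) → count P? xs ≡ ∑ xs (indicator ∘ P?)
count≡∑ P? []       = refl
count≡∑ P? (x ∷ xs) = trans (count-∷ P? x xs) (cong (indicator (P? x) +_) (count≡∑ P? xs))

∑-count-swap : {R : B.REL A A′ 0ℓ} (R? : B.Decidable R) (xs : List A) (ys : List A′) →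
               ∑ xs (λ x → count (R? x) ys) ≡ ∑ ys (λ y → count (flip R? y) xs)
∑-count-swap R? []       ys = sym (∑-0 ys)
∑-count-swap R? (x ∷ xs) ys = begin
  count (R? x) ys + ∑ xs (λ z → count (R? z) ys)
    ≡⟨ cong₂ _+_ (count≡∑ (R? x) ys) (∑-count-swap R? xs ys) ⟩
  ∑ ys (λ y → indicator (R? x y)) + ∑ ys (λ y → count (flip R? y) xs)
    ≡⟨ ∑-+ _ _ ys ⟨
  ∑ ys (λ y → indicator (R? x y) + count (flip R? y) xs)
    ≡⟨ ∑-cong (λ y → sym (count-∷ (flip R? y) x xs)) ys ⟩
  ∑ ys (λ y → count (flip R? y) (x ∷ xs)) ∎
  where open ≡-Reasoning

∑-bound : (f : A → ℕ) (E S : ℕ) (xs : List A) → (∀ {x} → x ∈ xs → f x * E ≤ S) →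
          ∑ xs f * E ≤ length xs * S
∑-bound f E S []       f≤ = z≤n
∑-bound f E S (x ∷ xs) f≤ = ≤-trans (≤-reflexive (*-distribʳ-+ E (f x) _))
  (+-mono-≤ (f≤ (here refl)) (∑-bound f E S xs (f≤ ∘ there)))

∑-concatMap-bound : (f : A → ℕ) (g : A′ → List A) (E S : ℕ) (ks : List A′) →
                    (∀ {k} → k ∈ ks → ∑ (g k) f * E ≤ S) → ∑ (concatMap g ks) f * E ≤ length ks * S
∑-concatMap-bound f g E S []       f≤ = z≤n
∑-concatMap-bound f g E S (k ∷ ks) f≤ = begin
  ∑ (g k ++ concatMap g ks) f * E             ≡⟨ cong (_* E) (∑-++ f (g k) _) ⟩
  (∑ (g k) f + ∑ (concatMap g ks) f) * E      ≡⟨ *-distribʳ-+ E (∑ (g k) f) _ ⟩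
  ∑ (g k) f * E + ∑ (concatMap g ks) f * E
    ≤⟨ +-mono-≤ (f≤ (here refl)) (∑-concatMap-bound f g E S ks (f≤ ∘ there)) ⟩
  S + length ks * S                           ∎
  where open ≤-Reasoning

concatMap-⊇ : (g : A′ → List A) {k : A′} {ks : List A′} → k ∈ ks → g k ⊆ concatMap g ks
concatMap-⊇ g {ks = _ ∷ ks} (here refl) = ++⁺ʳ (concatMap g ks) ⊆-refl
concatMap-⊇ g {ks = l ∷ _}  (there k∈)  = ++⁺ˡ (g l) (concatMap-⊇ g k∈)

concatMap-⊆ : (g : A′ → List A) {W : List A} (ks : List A′) {x : A} → (∀ {k} → k ∈ ks → g k ⊆ W) →
              x ∈ concatMap g ks → x ∈ W
concatMap-⊆ g (k ∷ ks) sub x∈ with ∈-++⁻ (g k) x∈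
... | inj₁ x∈gk = lookup (sub (here refl)) x∈gk
... | inj₂ x∈ks = concatMap-⊆ g ks (sub ∘ there) x∈ks

length-concatMap : (g : A′ → List A) (M : ℕ) (ks : List A′) → (∀ {k} → k ∈ ks → length (g k) ≡ M) →
                   length (concatMap g ks) ≡ length ks * M
length-concatMap g M []       len = refl
length-concatMap g M (k ∷ ks) len =
  trans (length-++ (g k)) (cong₂ _+_ (len (here refl)) (length-concatMap g M ks (len ∘ there)))

markov : {P : Pred A 0ℓ} (P? : Decidable P) (f : A → ℕ) (S E : ℕ) →
         (∀ x → P x → S ≤ f x * E) → ∀ xs → count P? xs * S ≤ ∑ xs f * E
markov P? f S E heavy []       = z≤n
markov P? f S E heavy (x ∷ xs) = begin
  count P? (x ∷ xs) * S                    ≡⟨ cong (_* S) (count-∷ P? x xs) ⟩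
  (indicator (P? x) + count P? xs) * S     ≡⟨ *-distribʳ-+ S (indicator (P? x)) _ ⟩
  indicator (P? x) * S + count P? xs * S   ≤⟨ +-mono-≤ (head (P? x)) (markov P? f S E heavy xs) ⟩
  f x * E + ∑ xs f * E                     ≡⟨ *-distribʳ-+ E (f x) _ ⟨
  ∑ (x ∷ xs) f * E                         ∎
  where
  open ≤-Reasoning
  head : (p : Dec _) → indicator p * S ≤ f x * E
  head (yes p) = ≤-trans (≤-reflexive (*-identityˡ S)) (heavy x p)
  head (no _)  = z≤n

module _ {R : B.Rel A 0ℓ} (R? : B.Decidable R) (R-sym : B.Symmetric R) where

  edgeCount : List A → List A → ℕ
  edgeCount X Y = ∑ X (λ x → count (R? x) Y)

  edgeCount-comm : ∀ X Y → edgeCount X Y ≡ edgeCount Y X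
  edgeCount-comm X Y = trans (∑-count-swap R? X Y)
    (∑-cong (λ y → cong length (filter-≐ (flip R? y) (R? y) (R-sym , R-sym) X)) Y)

  -- Markov's inequality: a heavy y sends more than S / E edges to U, and the sparsity leaves room
  -- for at most half of Y to do so.
  few-heavy : ∀ E S → 0 < S → ∀ U Y → edgeCount U Y * (2 * E) ≤ S * length Y →
              length Y ≤ 2 * count (λ y → count (R? y) U * E ≤? S) Y
  few-heavy E S 0<S U Y sparse = +-cancelʳ-≤ (length Y) _ _ $ begin
    length Y + length Y       ≡⟨ cong (length Y +_) (+-identityʳ (length Y)) ⟨
    2 * length Y              ≤⟨ *-monoʳ-≤ 2 (count-split light? heavy? (λ _ → ≰⇒>) Y) ⟩
    2 * (light + heavy)       ≡⟨ *-distribˡ-+ 2 light heavy ⟩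
    2 * light + 2 * heavy     ≤⟨ +-monoʳ-≤ (2 * light) 2heavy≤ ⟩
    2 * light + length Y      ∎
    where
    open ≤-Reasoning
    light? = λ y → count (R? y) U * E ≤? S
    heavy? = λ y → S <? count (R? y) U * E
    light = count light? Y
    heavy = count heavy? Y
    2heavy≤ : 2 * heavy ≤ length Y
    2heavy≤ = *-cancelˡ-≤ S ⦃ >-nonZero 0<S ⦄ $ begin
      S * (2 * heavy)        ≡⟨ *-comm S (2 * heavy) ⟩
      2 * heavy * S          ≡⟨ *-assoc 2 heavy S ⟩
      2 * (heavy * S)        ≤⟨ *-monoʳ-≤ 2 (markov heavy? _ S E (λ _ → <⇒≤) Y) ⟩
      2 * (edgeCount Y U * E)    ≡⟨ cong (λ m → 2 * (m * E)) (edgeCount-comm Y U) ⟩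
      2 * (edgeCount U Y * E)    ≡⟨ *-assoc 2 (edgeCount U Y) E ⟨
      2 * edgeCount U Y * E      ≡⟨ cong (_* E) (*-comm 2 (edgeCount U Y)) ⟩
      edgeCount U Y * 2 * E      ≡⟨ *-assoc (edgeCount U Y) 2 E ⟩
      edgeCount U Y * (2 * E)    ≤⟨ sparse ⟩
      S * length Y           ∎

∑≤length*max : (f : A → ℕ) (x : A) (xs : List A) →
               ∃[ y ] (y ∈ x ∷ xs × ∑ (x ∷ xs) f ≤ length (x ∷ xs) * f y)
∑≤length*max f x []        = x , here refl , ≤-refl
∑≤length*max f x (x′ ∷ xs) with ∑≤length*max f x′ xs
... | y , y∈ , ∑≤ with ≤-total (f x) (f y)
...   | inj₁ fx≤fy = y , there y∈ , +-mono-≤ fx≤fy ∑≤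
...   | inj₂ fy≤fx = x , here refl ,
  +-monoʳ-≤ (f x) (≤-trans ∑≤ (*-monoʳ-≤ (length (x′ ∷ xs)) fy≤fx))

-- Double counting of the pairs in `R`: there are at least as many as entries of `xs`, and the y in
-- the most pairs attains at least the average.
pigeonhole : {R : B.REL A A′ 0ℓ} (R? : B.Decidable R) {xs : List A} {ys : List A′} → 0 < length xs →
             (∀ {x} → x ∈ xs → ∃[ y ] (y ∈ ys × R x y)) →
             ∃[ y ] (y ∈ ys × length xs ≤ length ys * count (flip R? y) xs)
pigeonhole R? {x ∷ xs} {[]}     _ covered with () ← proj₁ (proj₂ (covered (here refl)))
pigeonhole R? {xs}     {z ∷ zs} _ covered =
  let y , y∈ , ∑≤ = ∑≤length*max (λ y → count (flip R? y) xs) z zs in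
  y , y∈ , (begin
    length xs                                  ≤⟨ length≤∑ xs covered ⟩
    ∑ xs (λ x → count (R? x) (z ∷ zs))         ≡⟨ ∑-count-swap R? xs (z ∷ zs) ⟩
    ∑ (z ∷ zs) (λ y → count (flip R? y) xs)    ≤⟨ ∑≤ ⟩
    length (z ∷ zs) * count (flip R? y) xs     ∎)
  where
  open ≤-Reasoning
  length≤∑ : ∀ us → (∀ {x} → x ∈ us → ∃[ y ] (y ∈ z ∷ zs × _)) →
             length us ≤ ∑ us (λ x → count (R? x) (z ∷ zs))
  length≤∑ []       cov = z≤n
  length≤∑ (u ∷ us) cov =
    let y , y∈ , r = cov (here refl) in
    +-mono-≤ (filter-some (R? u) (lose y∈ r)) (length≤∑ us (cov ∘ there))

AllPairs-⊆ : {R : B.Rel A 0ℓ} {xs ys : List A} → xs ⊆ ys → AllPairs R ys → AllPairs R xs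
AllPairs-⊆ []           []        = []
AllPairs-⊆ (_ ∷ʳ τ)     (_ ∷ rs)  = AllPairs-⊆ τ rs
AllPairs-⊆ (refl ∷ τ)   (r ∷ rs)  = All-resp-⊆ τ r ∷ AllPairs-⊆ τ rs

AllPairs-take-drop : {R : B.Rel A 0ℓ} {xs : List A} (m : ℕ) → AllPairs R xs →
                     ∀ {x y} → x ∈ take m xs → y ∈ drop m xs → R x y
AllPairs-take-drop (suc m) (r ∷ rs) (here refl) y∈ = All.lookup r (lookup (drop-⊆ m _) y∈)
AllPairs-take-drop (suc m) (r ∷ rs) (there x∈)  y∈ = AllPairs-take-drop m rs x∈ y∈

block : ℕ → ℕ → List A → List A
block b i xs = drop (i * b) (take (suc i * b) xs)

block-⊆ : ∀ b i (xs : List A) → block b i xs ⊆ xs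
block-⊆ b i xs = ⊆-trans (drop-⊆ (i * b) _) (take-⊆ (suc i * b) xs)

length-block : ∀ b i {xs : List A} → suc i * b ≤ length xs → length (block b i xs) ≡ b
length-block b i {xs} fits = begin
  length (block b i xs)                ≡⟨ length-drop (i * b) (take (suc i * b) xs) ⟩
  length (take (suc i * b) xs) ∸ i * b ≡⟨ cong (_∸ i * b) (length-take (suc i * b) xs) ⟩
  (suc i * b) ⊓ length xs ∸ i * b      ≡⟨ cong (_∸ i * b) (m≤n⇒m⊓n≡m fits) ⟩
  b + i * b ∸ i * b                    ≡⟨ m+n∸n≡m b (i * b) ⟩
  b                                    ∎
  where open ≡-Reasoning

block-increasing : {R : B.Rel A 0ℓ} {xs : List A} → AllPairs R xs → ∀ b {i k} → i < k →
                   ∀ {x y} → x ∈ block b i xs → y ∈ block b k xs → R x y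
block-increasing {xs = xs} sorted b {i} {k} i<k x∈ y∈ =
  AllPairs-take-drop (suc i * b) sorted
    (lookup (drop-⊆ (i * b) _) x∈)
    (lookup (⊆-drop⁺ (*-monoˡ-≤ b i<k) (take-⊆ (suc k * b) xs)) y∈)

-- Greedy embedding along a degeneracy order

∈-nonempty : {xs : List A} → 0 < length xs → ∃[ x ] x ∈ xs
∈-nonempty {xs = x ∷ _} _ = x , here refl

module _ {n : ℕ} (H : OrderedGraph n) where

  -- β is a budget: while the list is traversed, β w bounds the number of neighbours of w still to
  -- come before w, and passing v uses up one unit at each neighbour of v.
  spend : Fin n → (Fin n → ℕ) → Fin n → ℕ
  spend v β w = if does (adj? H v w) then pred (β w) else β w

  -- Every w in the list has at most β w neighbours in front of it.
  data BackDegrees (β : Fin n → ℕ) : List (Fin n) → Set where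
    []  : BackDegrees β []
    _∷_ : ∀ {v vs} → (∀ {w} → w ∈ vs → Adj H v w → 0 < β w) →
          BackDegrees (spend v β) vs → BackDegrees β (v ∷ vs)

  module _ {G : B.Rel A 0ℓ} (G? : B.Decidable G) (G-sym : B.Symmetric G)
           (T C : ℕ) (0<T : 0 < T) (0<C : 0 < C) (a₀ : A) where

    record Embedded (vs : List (Fin n)) (V : Fin n → List A) : Set where
      field
        place    : Fin n → A
        place-∈  : ∀ {w} → w ∈ vs → place w ∈ V w
        place-G  : ∀ {u w} → u ∈ vs → w ∈ vs → Adj H u w → G (place u) (place w)

    -- The trace of a failed attempt. X consists of the candidates of v for which w is to blame. The
    -- spare factor T in `Y-size` is there because w had a neighbour, v, still to be embedded before
    -- it.
    record Stuck (ℓ : ℕ) (V : Fin n → List A) : Set where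
      field
        {v w}  : Fin n
        {X Y}  : List A
        adj    : Adj H v w
        X⊆     : X ⊆ V v
        Y⊆     : Y ⊆ V w
        X-size : C ≤ ℓ * length X
        Y-size : T * C ≤ length Y
        few    : ∀ {x} → x ∈ X → T * count (G? x) Y < length Y

    restrict : Fin n → A → (Fin n → List A) → Fin n → List A
    restrict v x V w = if does (adj? H v w) then filter (G? x) (V w) else V w

    restrict-⊆ : ∀ v x V w → restrict v x V w ⊆ V w
    restrict-⊆ v x V w with does (adj? H v w)
    ... | true  = filter-⊆ (G? x) (V w)
    ... | false = ⊆-refl

    restrict-G : ∀ {v x V w y} → Adj H v w → y ∈ restrict v x V w → G x y
    restrict-G {v} {x} {V} {w} vw y∈ with adj? H v w
    ... | yes _  = proj₂ (∈-filter⁻ (G? x) {xs = V w} y∈)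
    ... | no ¬vw = contradiction vw ¬vw

    -- A candidate x of v is good if every later neighbour of v keeps a 1 / T fraction of its
    -- candidates. If none is good, each is bad for some later neighbour, and by pigeonhole a single
    -- w is to blame for a 1 / |vs| fraction of them; these form X, and Y is V w.
    embed-greedily : ∀ β vs V → BackDegrees β vs → (∀ {w} → w ∈ vs → T ^ β w * C ≤ length (V w)) →
                     Embedded vs V ⊎ Stuck (length vs) V
    -- Only listed vertices have to be placed properly; all others get the default `a₀`.
    embed-greedily β []       V []             large = inj₁ record
      { place = λ _ → a₀ ; place-∈ = λ () ; place-G = λ () }
    embed-greedily β (v ∷ vs) V (back ∷ backs) large = go (any? good? (V v))
      where
      Bad : A → Fin n → Set
      Bad x w = Adj H v w × T * count (G? x) (V w) < length (V w)

      bad? : ∀ x w → Dec (Bad x w)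
      bad? x w = adj? H v w ×-dec (_ <? _)

      good? : ∀ x → Dec (¬ Any (Bad x) vs)
      good? x = ¬? (any? (bad? x) vs)

      T^βv>0 : ∀ w → 0 < T ^ β w
      T^βv>0 w = m^n>0 T ⦃ >-nonZero 0<T ⦄ (β w)

      C≤Vv : C ≤ length (V v)
      C≤Vv = ≤-trans (m≤n*m C _ ⦃ >-nonZero (T^βv>0 v) ⦄) (large (here refl))

      -- A neighbour of v pays for the loss of a factor T with one unit of its budget.
      restrict-large : ∀ {x} → ¬ Any (Bad x) vs →
                       ∀ {w} → w ∈ vs → T ^ spend v β w * C ≤ length (restrict v x V w)
      restrict-large {x} good {w} w∈ with adj? H v w | back {w} w∈ | large (there w∈)
      ... | no _   | _    | Vw≥ = Vw≥
      ... | yes vw | 0<βw | Vw≥ = *-cancelˡ-≤ T ⦃ >-nonZero 0<T ⦄ (begin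
        T * (T ^ pred (β w) * C)    ≡⟨ *-assoc T (T ^ pred (β w)) C ⟨
        T ^ suc (pred (β w)) * C
          ≡⟨ cong (λ b → T ^ b * C) (suc-pred (β w) ⦃ >-nonZero (0<βw vw) ⦄) ⟩
        T ^ β w * C                 ≤⟨ Vw≥ ⟩
        length (V w)                ≤⟨ ≮⇒≥ (λ lt → good (lose w∈ (vw , lt))) ⟩
        T * count (G? x) (V w)      ∎)
        where open ≤-Reasoning

      extend : ∀ {x} → x ∈ V v → Embedded vs (restrict v x V) → Embedded (v ∷ vs) V
      extend {x} x∈ emb = record { place = place′ ; place-∈ = place′-∈ ; place-G = place′-G }
        where
        open Embedded emb
        place′ : Fin n → A
        place′ w with w F.≟ v
        ... | yes _ = x
        ... | no  _ = place w
        place′-∈ : ∀ {w} → w ∈ v ∷ vs → place′ w ∈ V w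
        place′-∈ {w} w∈ with w F.≟ v | w∈
        ... | yes refl | _         = x∈
        ... | no w≢v   | here w≡v  = contradiction w≡v w≢v
        ... | no _     | there w∈′ = lookup (restrict-⊆ v x V w) (place-∈ w∈′)
        place′-G : ∀ {u w} → u ∈ v ∷ vs → w ∈ v ∷ vs → Adj H u w → G (place′ u) (place′ w)
        place′-G {u} {w} u∈ w∈ uw with u F.≟ v | w F.≟ v | u∈ | w∈
        ... | yes refl | yes refl | _         | _         = contradiction uw (irrefl H refl)
        ... | no u≢v   | _        | here u≡v  | _         = contradiction u≡v u≢v
        ... | _        | no w≢v   | _         | here w≡v  = contradiction w≡v w≢v
        ... | yes refl | no _     | _         | there w∈′ = restrict-G {V = V} uw (place-∈ w∈′)
        ... | no _     | yes refl | there u∈′ | _         =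
          G-sym (restrict-G {V = V} (symm H uw) (place-∈ u∈′))
        ... | no _     | no _     | there u∈′ | there w∈′ = place-G u∈′ w∈′ uw

      stuck-⊆ : ∀ {x} → Stuck (length vs) (restrict v x V) → Stuck (length (v ∷ vs)) V
      stuck-⊆ {x} st = record
        { adj = adj ; few = few ; Y-size = Y-size
        ; X⊆ = ⊆-trans X⊆ (restrict-⊆ v x V _) ; Y⊆ = ⊆-trans Y⊆ (restrict-⊆ v x V _)
        ; X-size = ≤-trans X-size (*-monoˡ-≤ (length X) (n≤1+n (length vs))) }
        where open Stuck st hiding (v)

      go : Dec (Any (λ x → ¬ Any (Bad x) vs) (V v)) →
           Embedded (v ∷ vs) V ⊎ Stuck (length (v ∷ vs)) V
      go (yes some) =
        let x , x∈ , good = find some in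
        Sum.map (extend x∈) stuck-⊆
          (embed-greedily (spend v β) vs (restrict v x V) backs (restrict-large good))
      go (no none) = inj₂ record
        { adj = vw ; X⊆ = filter-⊆ _ (V v) ; Y⊆ = ⊆-refl
        ; X-size = ≤-trans X-size (*-monoˡ-≤ (length X) (n≤1+n (length vs)))
        ; Y-size = ≤-trans (*-monoˡ-≤ C T≤) (large (there w∈))
        ; few = λ x∈ → proj₂ (X-bad x∈) }
        where
        covered : ∀ {x} → x ∈ V v → ∃[ w ] (w ∈ vs × Bad x w)
        covered {x} x∈ with any? (bad? x) vs
        ... | yes bad = find bad
        ... | no ¬bad = contradiction (lose x∈ ¬bad) none
        chosen = pigeonhole bad? (≤-trans 0<C C≤Vv) covered
        w = proj₁ chosen
        w∈ = proj₁ (proj₂ chosen)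
        X = filter (λ x → bad? x w) (V v)
        X-size : C ≤ length vs * length X
        X-size = ≤-trans C≤Vv (proj₂ (proj₂ chosen))
        X-bad : ∀ {x} → x ∈ X → Bad x w
        X-bad x∈ = proj₂ (∈-filter⁻ (λ x → bad? x w) {xs = V v} x∈)
        -- The adjacency of v and w is part of `Bad x w`, so any element of X supplies it.
        0<X : 0 < length X
        0<X = n≢0⇒n>0 (λ X≡0 → <⇒≱ 0<C (≤-trans X-size
          (≤-reflexive (trans (cong (length vs *_) X≡0) (*-zeroʳ (length vs))))))
        vw : Adj H v w
        vw = proj₁ (X-bad (proj₂ (∈-nonempty 0<X)))
        -- As v comes before its neighbour w, the budget of w is at least 1 and V w has a factor T
        -- to spare.
        T≤ : T ≤ T ^ β w
        T≤ = ≤-trans (≤-reflexive (sym (*-identityʳ T)))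
          (^-monoʳ-≤ T ⦃ >-nonZero 0<T ⦄ (back w∈ vw))

-- Existence of degeneracy orders

∈-tabulate⁺ : ∀ {n} {P : Pred (Fin n) 0ℓ} (P? : Decidable P) {x} → P x → x ∈ₛ tabulate (does ∘ P?)
∈-tabulate⁺ P? {x} px = lookup⇒[]= x _ (trans (lookup∘tabulate (does ∘ P?) x) (dec-true (P? x) px))

∈-tabulate⁻ : ∀ {n} {P : Pred (Fin n) 0ℓ} (P? : Decidable P) {x} → x ∈ₛ tabulate (does ∘ P?) → P x
∈-tabulate⁻ P? {x} x∈ with P? x | trans (sym (lookup∘tabulate (does ∘ P?) x)) ([]=⇒lookup x∈)
... | yes px | _ = px
... | no _   | ()

x∉p∖x : ∀ {n} (p : Subset n) (x : Fin n) → x ∉ₛ p ∖ x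
x∉p∖x (inside  ∷ p) (F.zero)  ()
x∉p∖x (outside ∷ p) (F.zero)  ()
x∉p∖x (_ ∷ p) (F.suc x) (there x∈) = x∉p∖x p x x∈

unique-length≤ : ∀ {n} {xs : List (Fin n)} {p : Subset n} → Unique xs →
                 (∀ {x} → x ∈ xs → x ∈ₛ p) → length xs ≤ ∣ p ∣
unique-length≤ {xs = []}          _              _   = z≤n
unique-length≤ {xs = x ∷ xs} {p} (x∉ ∷ unique) xs⊆p = ≤-<-trans
  (unique-length≤ unique (λ y∈ → x∈p∧x≢y⇒x∈p-y (xs⊆p (there y∈)) (≢-sym (All.lookup x∉ y∈))))
  (x∈p⇒∣p-x∣<∣p∣ (xs⊆p (here refl)))

module _ {n} (H : OrderedGraph n) where

  -- `BackDegrees` recurses from the front, whereas a degeneracy order grows at the back. Each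
  -- earlier neighbour takes one unit from β v, so it is enough that β v is at least their number;
  -- the vertices in front of v are not affected.
  backDegrees-∷ʳ : ∀ {β v vs} → BackDegrees H β vs → count (adj? H v) vs ≤ β v →
                   BackDegrees H β (vs ++ v ∷ [])
  backDegrees-∷ʳ []                                      _  = (λ ()) ∷ []
  backDegrees-∷ʳ {β} {v} (_∷_ {u} {vs} back backs) fits = back′ ∷ backDegrees-∷ʳ backs fits′
    where
    fits-∷ : indicator (adj? H v u) + count (adj? H v) vs ≤ β v
    fits-∷ = ≤-trans (≤-reflexive (sym (count-∷ (adj? H v) u vs))) fits
    back′ : ∀ {w} → w ∈ vs ++ v ∷ [] → Adj H u w → 0 < β w
    back′ w∈ uw with ∈-++⁻ vs w∈
    ... | inj₁ w∈vs = back w∈vs uw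
    ... | inj₂ (here refl) with adj? H v u | fits-∷
    ...   | yes _  | 1≤βv = ≤-trans (s≤s z≤n) 1≤βv
    ...   | no ¬vu | _    = contradiction (symm H uw) ¬vu
    fits′ : count (adj? H v) vs ≤ spend H u β v
    fits′ with adj? H u v | adj? H v u | fits-∷
    ... | yes _  | yes _  | le = pred-mono-≤ le
    ... | yes uv | no ¬vu | _  = contradiction (symm H uv) ¬vu
    ... | no _   | _      | le = m+n≤o⇒n≤o _ le

  induced : Subset n → OrderedGraph n
  induced S = record
    { Adj    = λ u v → Adj H u v × u ∈ₛ S × v ∈ₛ S
    ; symm   = λ (uv , u∈ , v∈) → symm H uv , v∈ , u∈
    ; irrefl = λ u≡v (uv , _) → irrefl H u≡v uv
    ; adj?   = λ u v → adj? H u v ×-dec (u ∈ₛ? S) ×-dec (v ∈ₛ? S)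
    }

  record DegeneracyOrder (d : ℕ) (S : Subset n) : Set where
    field
      vertices : List (Fin n)
      sound    : ∀ {v} → v ∈ vertices → v ∈ₛ S
      complete : ∀ {v} → v ∈ₛ S → v ∈ vertices
      unique   : Unique vertices
      back     : BackDegrees H (λ _ → d) vertices

  -- A vertex of degree at most d in the subgraph induced on S is put last, behind all its
  -- neighbours in S; the rest of S is ordered recursively. The bound `k` makes the recursion
  -- structural.
  degeneracyOrder : ∀ {d} → Degenerate d H → ∀ k S → ∣ S ∣ ≤ k → DegeneracyOrder d S
  degeneracyOrder {d} degenerate k S ∣S∣≤k with nonempty? S
  ... | no empty = record
    { vertices = [] ; sound = λ () ; complete = λ v∈ → contradiction (_ , v∈) empty
    ; unique = [] ; back = [] }
  degeneracyOrder {d} degenerate zero S ∣S∣≤0 | yes (v , v∈) =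
    contradiction (≤-trans (x∈p⇒∣p-x∣<∣p∣ v∈) ∣S∣≤0) λ ()
  degeneracyOrder {d} degenerate (suc k) S ∣S∣≤k | yes nonempty
    with v , v∈ , deg≤d ← degenerate S (induced S)
           (record { edges = proj₁ ; endpoints = λ (_ , u∈ , _) → u∈ }) nonempty = record
    { vertices = vertices ++ v ∷ []
    ; sound    = sound′
    ; complete = complete′
    ; unique   = Unique.++⁺ unique ([] ∷ []) λ { (v∈vs , here refl) → x∉p∖x S v (sound v∈vs) }
    -- `degree` is the size of a subset, so it bounds the list of earlier neighbours only because
    -- that list has no repetitions.
    ; back     = backDegrees-∷ʳ back (≤-trans
        (unique-length≤ (Unique.filter⁺ (adj? H v) unique) nbr) deg≤d)
    }
    where
    open DegeneracyOrder
      (degeneracyOrder degenerate k (S ∖ v) (≤-pred (≤-trans (x∈p⇒∣p-x∣<∣p∣ v∈) ∣S∣≤k)))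
    sound′ : ∀ {w} → w ∈ vertices ++ v ∷ [] → w ∈ₛ S
    sound′ w∈ with ∈-++⁻ vertices w∈
    ... | inj₁ w∈vs        = p─q⊆p S _ (sound w∈vs)
    ... | inj₂ (here refl) = v∈
    complete′ : ∀ {w} → w ∈ₛ S → w ∈ vertices ++ v ∷ []
    complete′ {w} w∈ with w F.≟ v
    ... | yes refl = ∈-++⁺ʳ vertices (here refl)
    ... | no w≢v   = ∈-++⁺ˡ (complete (x∈p∧x≢y⇒x∈p-y w∈ w≢v))
    nbr : ∀ {w} → w ∈ filter (adj? H v) vertices → w ∈ₛ _
    nbr w∈ = let w∈vs , vw = ∈-filter⁻ (adj? H v) {xs = vertices} w∈ in
      ∈-tabulate⁺ (adj? (induced S) v) (vw , v∈ , p─q⊆p S _ (sound w∈vs))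

-- The parts are renumbered in increasing order: part c precedes part v when it
-- is another part containing a vertex below v.
module _ {n k} {H : OrderedGraph n} (colouring : IntervalColouring H k) where
  open IntervalColouring colouring

  Before : Fin n → Fin k → Set
  Before v c = c ≢ part v × ∃[ u ] (u F.< v × part u ≡ c)

  before? : ∀ v c → Dec (Before v c)
  before? v c = ¬? (c F.≟ part v) ×-dec F.any? (λ u → (u F.<? v) ×-dec (part u F.≟ c))

  rank : Fin n → ℕ
  rank v = ∣ tabulate (λ c → does (before? v c)) ∣

  -- The part of v itself is left out of the count.
  rank<k : ∀ v → rank v < k
  rank<k v = subst (rank v <_) (∣⊤∣≡n k)
    (p⊂q⇒∣p∣<∣q∣ ((λ _ → ∈⊤) , part v , ∈⊤ , λ v∈ → proj₁ (∈-tabulate⁻ (before? v) v∈) refl))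

  -- Were c the part of v, then u, lying between a vertex of c and v, would belong to c as well.
  before-mono : ∀ {u v} → u F.< v → ∀ {c} → Before u c → Before v c
  before-mono {u} {v} u<v (c≢ , w , w<u , refl) =
    (λ pw≡pv → c≢ (sym (interval (<⇒≤ w<u) (<⇒≤ u<v) pw≡pv))) , w , <-trans w<u u<v , refl

  rank-mono : ∀ {u v} → u F.< v → rank u ≤ rank v
  rank-mono u<v = p⊆q⇒∣p∣≤∣q∣ λ c∈ →
    ∈-tabulate⁺ (before? _) (before-mono u<v (∈-tabulate⁻ (before? _) c∈))

  -- The part of u is counted at v, since u and v lie in different parts, but it is not counted at
  -- u.
  rank-strict : ∀ {u v} → u F.< v → Adj H u v → rank u < rank v
  rank-strict {u} {v} u<v uv = p⊂q⇒∣p∣<∣q∣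
    ( (λ c∈ → ∈-tabulate⁺ (before? _) (before-mono u<v (∈-tabulate⁻ (before? _) c∈)))
    , part u
    , ∈-tabulate⁺ (before? v) (independent uv , u , u<v , refl)
    , λ u∈ → proj₁ (∈-tabulate⁻ (before? u) u∈) refl )

  rank-≢ : ∀ {u v} → Adj H u v → rank u ≢ rank v
  rank-≢ {u} {v} uv with F.<-cmp u v
  ... | B.tri< u<v _ _  = <⇒≢ (rank-strict u<v uv)
  ... | B.tri≈ _ u≡v _  = contradiction uv (irrefl H u≡v)
  ... | B.tri> _ _ v<u  = ≢-sym (<⇒≢ (rank-strict v<u (symm H uv)))

-- Existence of the Ramsey number

least : {P : ℕ → Set} → Decidable P → ∀ N → P N → ∃[ r ] (IsLeast P r × r ≤ N)
least {P} P? = <-rec _ step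
  where
  step : ∀ N → (∀ {m} → m < N → P m → ∃[ r ] (IsLeast P r × r ≤ m)) →
         P N → ∃[ r ] (IsLeast P r × r ≤ N)
  step N rec pN with anyUpTo? P? N
  ... | yes (m , m<N , pm) =
    let r , r-least , r≤m = rec m<N pm in r , r-least , ≤-trans r≤m (<⇒≤ m<N)
  ... | no none = N , (pN , λ m pm → ≮⇒≥ (λ m<N → none (m , m<N , pm))) , ≤-refl

module _ {m n} {P : (Fin m → Fin n) → Set} (P? : ∀ f → Dec (P f))
         (P-resp : ∀ {f g} → (∀ i → f i ≡ g i) → P f → P g) where

  -- Functions between finite sets are searched through their codes. Decoding returns a function
  -- only up to pointwise equality, hence the assumption `P-resp`.
  anyFunction? : Dec (∃[ f ] P f)
  anyFunction? = map′ (λ (k , p) → finToFun k , p)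
    (λ (f , p) → funToFin f , P-resp (λ i → sym (F.finToFun-funToFin f i)) p)
    (F.any? (P? ∘ finToFun))

  allFunctions? : Dec (∀ f → P f)
  allFunctions? = map′ (λ p f → P-resp (F.finToFun-funToFin f) (p (funToFin f)))
    (λ p → p ∘ finToFun)
    (F.all? (P? ∘ finToFun))

orderedCopy? : ∀ {m n} (H : OrderedGraph m) (G : OrderedGraph n) → Dec (OrderedCopy H G)
orderedCopy? H G = map′
  (λ (f , inc , edg) → record
    { embed = f ; increasing = λ {i} {j} → inc i j ; edges = λ {i} {j} → edg i j })
  (λ copy → let open OrderedCopy copy in embed , (λ _ _ → increasing) , (λ _ _ → edges))
  (anyFunction?
    (λ f → F.all? (λ i → F.all? λ j → (i F.<? j) →-dec (f i F.<? f j)) ×-dec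
           F.all? (λ i → F.all? λ j → adj? H i j →-dec adj? G (f i) (f j)))
    (λ f≗g (inc , edg) →
      (λ i j i<j → subst₂ F._<_ (f≗g i) (f≗g j) (inc i j i<j)) ,
      (λ i j ij → subst₂ (Adj G) (f≗g i) (f≗g j) (edg i j ij))))

module _ {n} (H : OrderedGraph n) {N q : ℕ} where

  Monochromatic : EdgeColouring N q → Set
  Monochromatic κ = ∃[ c ] OrderedCopy H (colourClass (K< N) κ c)

  monochromatic? : ∀ κ → Dec (Monochromatic κ)
  monochromatic? κ = F.any? (λ c → orderedCopy? H (colourClass (K< N) κ c))

  open EdgeColouring

  monochromatic-resp : ∀ {κ λ′ : EdgeColouring N q} → (∀ u v → colour κ u v ≡ colour λ′ u v) →
                       Monochromatic κ → Monochromatic λ′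
  monochromatic-resp κ≗λ (c , copy) = c , record
    { embed = embed ; increasing = increasing
    ; edges = λ uv → let u≢v , col = edges uv in u≢v , trans (sym (κ≗λ _ _)) col }
    where open OrderedCopy copy

  symmetrise : (Fin N → Fin N → Fin q) → EdgeColouring N q
  symmetrise f = record { colour = col ; colour-symm = col-symm }
    where
    col : Fin N → Fin N → Fin q
    col u v = if does (u F.≤? v) then f u v else f v u
    col-symm : ∀ u v → col u v ≡ col v u
    col-symm u v = flip-symm (u F.≤? v) (v F.≤? u)
      where
      flip-symm : (u≤v? : Dec (u F.≤ v)) (v≤u? : Dec (v F.≤ u)) →
                  (if does u≤v? then f u v else f v u) ≡ (if does v≤u? then f v u else f u v)
      flip-symm (yes u≤v) (yes v≤u) = cong₂ f (F.≤-antisym u≤v v≤u) (F.≤-antisym v≤u u≤v)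
      flip-symm (yes _)   (no _)    = refl
      flip-symm (no _)    (yes _)   = refl
      flip-symm (no u≰v)  (no v≰u)  = contradiction (<⇒≤ (≰⇒> u≰v)) v≰u

  symmetrise-cong : ∀ {f g} → (∀ u v → f u v ≡ g u v) →
                    ∀ u v → colour (symmetrise f) u v ≡ colour (symmetrise g) u v
  symmetrise-cong f≗g u v with does (u F.≤? v)
  ... | true  = f≗g u v
  ... | false = f≗g v u

  symmetrise-colour : ∀ κ u v → colour (symmetrise (colour κ)) u v ≡ colour κ u v
  symmetrise-colour κ u v with does (u F.≤? v)
  ... | true  = refl
  ... | false = colour-symm κ v u

-- Only plain functions can be enumerated, so the symmetrisations of all of them are tested; a
-- symmetric colouring is its own symmetrisation. A table of colours is coded as a function into
-- `Fin (q ^ N)`, each value standing for one row.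
arrows? : ∀ {n} (H : OrderedGraph n) (q N : ℕ) → Dec (Arrows H q N)
arrows? H q N = map′
  (λ all κ → monochromatic-resp H
    (λ u v → trans (symmetrise-cong H (λ x → F.finToFun-funToFin (colour κ x)) u v)
                   (symmetrise-colour H κ u v))
    (all (λ x → funToFin (colour κ x))))
  (λ arrows f → arrows (symmetrise H (λ x → finToFun (f x))))
  (allFunctions? {N} {q ^ N} (λ f → monochromatic? H (symmetrise H (λ x → finToFun (f x))))
    (λ f≗g → monochromatic-resp H (symmetrise-cong H (λ u v → cong (λ k → finToFun k v) (f≗g u)))))
  where open EdgeColouring

-- Sparse pairs and sparse families

module _ {N : ℕ} where

  infix 4 _≺_
  _≺_ : List (Fin N) → List (Fin N) → Set
  X ≺ Y = ∀ {x y} → x ∈ X → y ∈ Y → x F.< y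

  ≺-⊆ : ∀ {X X′ Y Y′} → X ⊆ X′ → Y ⊆ Y′ → X′ ≺ Y′ → X ≺ Y
  ≺-⊆ X⊆ Y⊆ X′≺Y′ x∈ y∈ = X′≺Y′ (lookup X⊆ x∈) (lookup Y⊆ y∈)

  Sorted : List (Fin N) → Set
  Sorted = AllPairs F._<_

  -- The indices are plain numbers with separate bounds, so that `combine` can join two families by
  -- shifting indices; nothing is required of `part` from K on.
  record Family (K M : ℕ) (Sparse : List (Fin N) → List (Fin N) → Set)
                (W : List (Fin N)) : Set where
    field
      part       : ℕ → List (Fin N)
      part-⊆     : ∀ {i} → i < K → part i ⊆ W
      part-size  : ∀ {i} → i < K → length (part i) ≡ M
      part-≺     : ∀ {i k} → i < k → k < K → part i ≺ part k
      sparse     : ∀ {i k} → i < K → k < K → i ≢ k → Sparse (part i) (part k)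

  blocks : ∀ {K M W} {Sparse : List (Fin N) → List (Fin N) → Set} →
           Sorted W → K * M ≤ length W → (∀ X Y → Sparse X Y) → Family K M Sparse W
  blocks {K} {M} {W} sorted large all-sparse = record
    { part      = λ i → block M i W
    ; part-⊆    = λ {i} _ → block-⊆ M i W
    ; part-size = λ {i} i<K → length-block M i (≤-trans (*-monoˡ-≤ M i<K) large)
    ; part-≺    = λ i<k _ → block-increasing sorted M i<k
    ; sparse    = λ _ _ _ → all-sparse _ _
    }

  combine : ∀ {K₁ K₂ M W₁ W₂ W} {Sparse : List (Fin N) → List (Fin N) → Set} → B.Symmetric Sparse →
            W₁ ⊆ W → W₂ ⊆ W → W₁ ≺ W₂ →
            (F₁ : Family K₁ M Sparse W₁) (F₂ : Family K₂ M Sparse W₂) →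
            (∀ {i k} → i < K₁ → k < K₂ → Sparse (Family.part F₁ i) (Family.part F₂ k)) →
            Family (K₁ + K₂) M Sparse W
  combine {K₁} {K₂} {M} {W₁} {W₂} {W} {Sparse} sparse-sym W₁⊆W W₂⊆W W₁≺W₂ F₁ F₂ cross = record
    { part = part ; part-⊆ = part-⊆ ; part-size = part-size ; part-≺ = part-≺ ; sparse = sparse }
    where
    module F₁ = Family F₁
    module F₂ = Family F₂

    part : ℕ → List (Fin N)
    part i = if does (i <? K₁) then F₁.part i else F₂.part (i ∸ K₁)

    low : ∀ {i} → i < K₁ → part i ≡ F₁.part i
    low {i} i<K₁ = cong (λ b → if b then F₁.part i else F₂.part (i ∸ K₁)) (dec-true (i <? K₁) i<K₁)

    high : ∀ {i} → ¬ i < K₁ → part i ≡ F₂.part (i ∸ K₁)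
    high {i} i≮K₁ = cong (λ b → if b then F₁.part i else F₂.part (i ∸ K₁))
      (dec-false (i <? K₁) i≮K₁)

    high< : ∀ {i} → ¬ i < K₁ → i < K₁ + K₂ → i ∸ K₁ < K₂
    high< {i} i≮K₁ i< = +-cancelˡ-< K₁ _ _ (subst (_< K₁ + K₂) (sym (m+[n∸m]≡n (≮⇒≥ i≮K₁))) i<)

    part-⊆ : ∀ {i} → i < K₁ + K₂ → part i ⊆ W
    part-⊆ {i} i< with i <? K₁
    ... | yes lt = subst (_⊆ W) (sym (low lt)) (⊆-trans (F₁.part-⊆ lt) W₁⊆W)
    ... | no ge  = subst (_⊆ W) (sym (high ge)) (⊆-trans (F₂.part-⊆ (high< ge i<)) W₂⊆W)

    part-size : ∀ {i} → i < K₁ + K₂ → length (part i) ≡ M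
    part-size {i} i< with i <? K₁
    ... | yes lt = trans (cong length (low lt)) (F₁.part-size lt)
    ... | no ge  = trans (cong length (high ge)) (F₂.part-size (high< ge i<))

    part-≺ : ∀ {i k} → i < k → k < K₁ + K₂ → part i ≺ part k
    part-≺ {i} {k} i<k k< with i <? K₁ | k <? K₁
    ... | yes _  | yes lt = subst₂ _≺_ (sym (low (<-trans i<k lt))) (sym (low lt)) (F₁.part-≺ i<k lt)
    ... | yes lt | no ge  = subst₂ _≺_ (sym (low lt)) (sym (high ge))
      (≺-⊆ (F₁.part-⊆ lt) (F₂.part-⊆ (high< ge k<)) W₁≺W₂)
    ... | no ge  | yes lt = contradiction (<-trans i<k lt) ge
    ... | no ge  | no ge′ = subst₂ _≺_ (sym (high ge)) (sym (high ge′))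
      (F₂.part-≺ (∸-monoˡ-< i<k (≮⇒≥ ge)) (high< ge′ k<))

    sparse : ∀ {i k} → i < K₁ + K₂ → k < K₁ + K₂ → i ≢ k → Sparse (part i) (part k)
    sparse {i} {k} i< k< i≢k with i <? K₁ | k <? K₁
    ... | yes lt | yes lt′ = subst₂ Sparse (sym (low lt)) (sym (low lt′)) (F₁.sparse lt lt′ i≢k)
    ... | yes lt | no ge   = subst₂ Sparse (sym (low lt)) (sym (high ge)) (cross lt (high< ge k<))
    ... | no ge  | yes lt  =
      sparse-sym (subst₂ Sparse (sym (low lt)) (sym (high ge)) (cross lt (high< ge i<)))
    ... | no ge  | no ge′  = subst₂ Sparse (sym (high ge)) (sym (high ge′))
      (F₂.sparse (high< ge i<) (high< ge′ k<) (i≢k ∘ ∸-cancelʳ-≡ (≮⇒≥ ge) (≮⇒≥ ge′)))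

  module _ {R : B.Rel (Fin N) 0ℓ} (R? : B.Decidable R) (R-sym : B.Symmetric R) where

    LowDegree : ℕ → ℕ → List (Fin N) → List (Fin N) → Set
    LowDegree E M X Y = ∀ {x} → x ∈ X → count (R? x) Y * E ≤ M

    -- For sets of size M this is edge density at most 1 / E. Unlike `LowDegree` it is symmetric in
    -- X and Y, so the recursive splitting can get by with pruning one side.
    LowDensity : ℕ → ℕ → List (Fin N) → List (Fin N) → Set
    LowDensity E M X Y = edgeCount R? R-sym X Y * E ≤ M * M

    lowDensity-sym : ∀ E M X Y → LowDensity E M X Y → LowDensity E M Y X
    lowDensity-sym E M X Y = subst (λ m → m * E ≤ M * M) (edgeCount-comm R? R-sym X Y)

    record SparsePair (E M : ℕ) (W : List (Fin N)) : Set where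
      field
        {X Y}   : List (Fin N)
        X⊆      : X ⊆ W
        Y⊆      : Y ⊆ W
        X-size  : M ≤ length X
        Y-size  : M ≤ length Y
        ordered : X ≺ Y ⊎ Y ≺ X
        sparse  : LowDegree E (length Y) X Y

    PairsIn : ℕ → ℕ → Set
    PairsIn P E = ∀ {M W} → 0 < M → Sorted W → P * M ≤ length W → SparsePair E M W

    FamiliesIn : ℕ → ℕ → ℕ → Set
    FamiliesIn K S E = ∀ {M W} → 0 < M → Sorted W → S * M ≤ length W → Family K M (LowDegree E M) W

    -- X is split first, into parts whose union is U.  A vertex of Y with many neighbours in U is
    -- discarded before Y is split, so nothing is lost by passing to tiny subsets of X and Y.
    pairs⇒dense-families : ∀ {P K E} → 0 < P → PairsIn P (K * E) →
                           ∀ h → 2 ^ h ≤ K → ∀ {M W} → 0 < M → Sorted W →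
                           (2 * P) ^ h * M ≤ length W → Family (2 ^ h) M (LowDensity E M) W
    pairs⇒dense-families _ pairs zero _ {M} {W} 0<M sorted large = record
      { part = λ _ → take M W
      ; part-⊆ = λ _ → take-⊆ M W
      ; part-size = λ _ → trans (length-take M W)
          (m≤n⇒m⊓n≡m (≤-trans (≤-reflexive (sym (+-identityʳ M))) large))
      ; part-≺ = λ { {i} {k} i<k (s≤s z≤n) → contradiction i<k λ () }
      ; sparse = λ { (s≤s z≤n) (s≤s z≤n) 0≢0 → contradiction refl 0≢0 }
      }
    pairs⇒dense-families {P} {K} {E} 0<P pairs (suc h) 2^h<K {M} {W} 0<M sorted large =
      subst (λ k → Family (2 ^ h + k) M _ W) (sym (+-identityʳ (2 ^ h))) (join ordered)
      where
      m = (2 * P) ^ h * M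

      -- Each side should have m vertices to split further; the factor 2 makes up for the half of Y
      -- that may be discarded.
      pair : SparsePair (K * E) (2 * m) W
      pair = pairs 0<2m sorted (≤-trans (≤-reflexive
        (solve 3 (λ P s M → P :* (con 2 :* (s :* M)) := con 2 :* P :* s :* M) refl
          P ((2 * P) ^ h) M)) large)
        where
        open +-*-Solver
        0<2m : 0 < 2 * m
        0<2m = *-mono-< {0} {2} (s≤s z≤n)
          (*-mono-< (m^n>0 (2 * P) ⦃ >-nonZero (*-mono-< {0} {2} (s≤s z≤n) 0<P) ⦄ h) 0<M)
      open SparsePair pair

      sub-families : ∀ {W′} → W′ ⊆ W → m ≤ length W′ → Family (2 ^ h) M (LowDensity E M) W′
      sub-families W′⊆W = pairs⇒dense-families {P} {K} {E} 0<P pairs h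
        (≤-trans (m≤m+n (2 ^ h) _) 2^h<K) 0<M (AllPairs-⊆ W′⊆W sorted)

      FX : Family (2 ^ h) M (LowDensity E M) X
      FX = sub-families X⊆ (≤-trans (m≤m+n m _) X-size)
      module FX = Family FX

      U = concatMap FX.part (upTo (2 ^ h))

      light? = λ y → count (R? y) U * E ≤? M
      Y* = filter light? Y

      -- Each of the 2 ^ h * M vertices of U has at most |Y| / (K * E) neighbours in Y. As 2 ^ (h +
      -- 1) ≤ K, this makes at most M * |Y| / (2 * E) edges.
      U-sparse : edgeCount R? R-sym U Y * (2 * E) ≤ M * length Y
      U-sparse = *-cancelˡ-≤ (2 ^ h) ⦃ m^n≢0 2 h ⦄ (begin
        2 ^ h * (ec * (2 * E))
          ≡⟨ solve 3 (λ a ec E → a :* (ec :* (con 2 :* E)) := ec :* (con 2 :* a :* E)) refl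
              (2 ^ h) ec E ⟩
        ec * (2 ^ suc h * E)             ≤⟨ *-monoʳ-≤ ec (*-monoˡ-≤ E 2^h<K) ⟩
        ec * (K * E)                     ≤⟨ ∑-bound _ (K * E) (length Y) U (sparse ∘ U⊆X) ⟩
        length U * length Y
          ≡⟨ cong (_* length Y) (length-concatMap FX.part M (upTo (2 ^ h)) (FX.part-size ∘ ∈-upTo⁻)) ⟩
        length (upTo (2 ^ h)) * M * length Y
          ≡⟨ cong (λ l → l * M * length Y) (length-upTo (2 ^ h)) ⟩
        2 ^ h * M * length Y             ≡⟨ *-assoc (2 ^ h) M _ ⟩
        2 ^ h * (M * length Y)           ∎)
        where
        open ≤-Reasoning
        open +-*-Solver
        ec = edgeCount R? R-sym U Y
        U⊆X : ∀ {x} → x ∈ U → x ∈ X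
        U⊆X = concatMap-⊆ FX.part (upTo (2 ^ h)) (FX.part-⊆ ∘ ∈-upTo⁻)

      Y*-size : m ≤ length Y*
      Y*-size = *-cancelˡ-≤ 2 (≤-trans Y-size (few-heavy R? R-sym E M 0<M U Y U-sparse))

      FY : Family (2 ^ h) M (LowDensity E M) Y*
      FY = sub-families (⊆-trans (filter-⊆ light? Y) Y⊆) Y*-size
      module FY = Family FY

      cross : ∀ {i k} → i < 2 ^ h → k < 2 ^ h → LowDensity E M (FY.part i) (FX.part k)
      cross {i} {k} i< k< = ≤-trans
        (∑-bound (λ y → count (R? y) (FX.part k)) E M (FY.part i) λ y∈ → ≤-trans
          (*-monoˡ-≤ E (count-⊆ (R? _) (concatMap-⊇ FX.part (∈-upTo⁺ k<))))
          (proj₂ (∈-filter⁻ light? {xs = Y} (lookup (FY.part-⊆ i<) y∈))))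
        (≤-reflexive (cong (_* M) (FY.part-size i<)))

      join : X ≺ Y ⊎ Y ≺ X → Family (2 ^ h + 2 ^ h) M (LowDensity E M) W
      join (inj₁ X≺Y) = combine (λ {X} {Y} → lowDensity-sym E M X Y) X⊆ (⊆-trans (filter-⊆ light? Y) Y⊆)
        (≺-⊆ ⊆-refl (filter-⊆ light? Y) X≺Y) FX FY
        (λ {i} {k} i< k< → lowDensity-sym E M (FY.part k) (FX.part i) (cross k< i<))
      join (inj₂ Y≺X) = combine (λ {X} {Y} → lowDensity-sym E M X Y) (⊆-trans (filter-⊆ light? Y) Y⊆) X⊆
        (≺-⊆ (filter-⊆ light? Y) ⊆-refl Y≺X) FY FX cross

    -- Between a part and the union of the others there are at most K * (2 * M) ^ 2 / (4 * K * E) =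
    -- M ^ 2 / E edges, so at least half of its 2 * M vertices have at most M / E neighbours in that
    -- union. Degrees are measured into the unpruned parts, so all parts can be pruned
    -- independently.
    dense⇒low-degree : ∀ {K E M W} → 0 < K → 0 < M →
                       Family K (2 * M) (LowDensity (4 * K * E) (2 * M)) W →
                       Family K M (LowDegree E M) W
    dense⇒low-degree {K} {E} {M} {W} 0<K 0<M D = record
      { part      = part
      ; part-⊆    = λ {i} i< → ⊆-trans (part⊆D i) (D.part-⊆ i<)
      ; part-size = λ {i} i< → trans (length-take M (filter (light? i) (D.part i)))
          (m≤n⇒m⊓n≡m (light-size i<))
      ; part-≺    = λ {i} {k} i<k k< → ≺-⊆ (part⊆D i) (part⊆D k) (D.part-≺ i<k k<)
      ; sparse    = sparse
      }
      where
      module D = Family D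
      others : ℕ → List ℕ
      others i = filter (λ k → ¬? (k ℕ.≟ i)) (upTo K)
      U : ℕ → List (Fin N)
      U i = concatMap D.part (others i)
      light? : ∀ i → Decidable (λ x → count (R? x) (U i) * E ≤ M)
      light? i x = count (R? x) (U i) * E ≤? M
      part : ℕ → List (Fin N)
      part i = take M (filter (light? i) (D.part i))

      part⊆light : ∀ i → part i ⊆ filter (light? i) (D.part i)
      part⊆light i = take-⊆ M _

      part⊆D : ∀ i → part i ⊆ D.part i
      part⊆D i = ⊆-trans (part⊆light i) (filter-⊆ (light? i) (D.part i))

      ∈-others : ∀ {i k} → k ∈ others i → k < K × k ≢ i
      ∈-others {i} k∈ = let k∈upTo , k≢i = ∈-filter⁻ (λ k → ¬? (k ℕ.≟ i)) {xs = upTo K} k∈ in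
        ∈-upTo⁻ k∈upTo , k≢i

      light-size : ∀ {i} → i < K → M ≤ count (light? i) (D.part i)
      light-size {i} i< = *-cancelˡ-≤ 2 (≤-trans (≤-reflexive (sym (D.part-size i<)))
        (few-heavy R? R-sym E M 0<M (U i) (D.part i) U-sparse))
        where
        open ≤-Reasoning
        open +-*-Solver
        ec = edgeCount R? R-sym (U i) (D.part i)
        U-sparse : ec * (2 * E) ≤ M * length (D.part i)
        U-sparse = *-cancelˡ-≤ (2 * K) ⦃ >-nonZero (*-mono-< {0} {2} (s≤s z≤n) 0<K) ⦄ (begin
          2 * K * (ec * (2 * E))
            ≡⟨ solve 3 (λ K ec E → con 2 :* K :* (ec :* (con 2 :* E)) := ec :* (con 4 :* K :* E)) refl
                K ec E ⟩
          ec * (4 * K * E)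
            ≤⟨ ∑-concatMap-bound _ D.part (4 * K * E) (2 * M * (2 * M)) (others i)
              (λ k∈ → let k< , k≢i = ∈-others k∈ in D.sparse k< i< k≢i) ⟩
          length (others i) * (2 * M * (2 * M))
            ≤⟨ *-monoˡ-≤ (2 * M * (2 * M))
              (≤-trans (length-filter _ (upTo K)) (≤-reflexive (length-upTo K))) ⟩
          K * (2 * M * (2 * M))
            ≡⟨ solve 2 (λ K M → K :* (con 2 :* M :* (con 2 :* M)) := con 2 :* K :* (M :* (con 2 :* M))) refl
                K M ⟩
          2 * K * (M * (2 * M))                ≡⟨ cong (λ l → 2 * K * (M * l)) (D.part-size i<) ⟨
          2 * K * (M * length (D.part i))      ∎)

      sparse : ∀ {i k} → i < K → k < K → i ≢ k → LowDegree E M (part i) (part k)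
      sparse {i} {k} i< k< i≢k {x} x∈ = ≤-trans
        (*-monoˡ-≤ E (count-⊆ (R? x) (⊆-trans (part⊆D k)
          (concatMap-⊇ D.part (∈-filter⁺ (λ l → ¬? (l ℕ.≟ i)) (∈-upTo⁺ k<) (≢-sym i≢k))))))
        (proj₂ (∈-filter⁻ (light? i) {xs = D.part i} (lookup (part⊆light i) x∈)))

    -- Each of the L rounds of splitting costs a factor 2 * P, and the final pruning of the parts
    -- costs 2. In the sparseness, one 2 ^ L is consumed by the splitting and 4 * 2 ^ L by the
    -- pruning.
    pairs⇒families : ∀ {P E} L → 0 < P → PairsIn P (2 ^ L * (4 * 2 ^ L * E)) →
                     FamiliesIn (2 ^ L) ((2 * P) ^ L * 2) E
    pairs⇒families {P} {E} L 0<P pairs {M} {W} 0<M sorted large =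
      dense⇒low-degree (m^n>0 2 L) 0<M
        (pairs⇒dense-families {P} {2 ^ L} {4 * 2 ^ L * E} 0<P pairs L ≤-refl
          (*-mono-< {0} {2} (s≤s z≤n) 0<M) sorted
          (≤-trans (≤-reflexive (sym (*-assoc ((2 * P) ^ L) 2 M))) large))

-- Vertex sets of size n ^ familyExponent d L j e * M contain 2 ^ L parts of size M whose degrees to one
-- another, in the first j colours, are at most M / n ^ e.
familyExponent : (d L j e : ℕ) → ℕ
familyExponent d L zero    e = 2
familyExponent d L (suc j) e = (3 + (7 + e) * d + familyExponent d L j (1 + (7 + e) * d)) * L + 1

-- Removing the colours one at a time

module _ {q N : ℕ} (κ : EdgeColouring N q) where

  open EdgeColouring κ

  -- This is the edge set R j of the opening explanation.
  Old : ℕ → Fin N → Fin N → Set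
  Old j x y = toℕ (colour x y) < j

  old? : ∀ j → B.Decidable (Old j)
  old? j x y = toℕ (colour x y) <? j

  old-sym : ∀ j → B.Symmetric (Old j)
  old-sym j {x} {y} = subst (λ c → toℕ c < j) (colour-symm x y)

module MonochromaticFree {n d K q N : ℕ} (2≤n : 2 ≤ n) {H : OrderedGraph n}
         (order : DegeneracyOrder H d ⊤)
         (p : Fin n → ℕ) (p<K : ∀ v → p v < K) (p-mono : ∀ {u v} → u F.< v → p u ≤ p v)
         (p-≢ : ∀ {u v} → Adj H u v → p u ≢ p v)
         (κ : EdgeColouring N q) (¬mono : ¬ Monochromatic H κ) where

  open EdgeColouring κ

  no-copy : ∀ c (f : Fin n → Fin N) → (∀ {u v} → u F.< v → f u F.< f v) →
            (∀ {u v} → Adj H u v → colour (f u) (f v) ≡ c) → ⊥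
  no-copy c f increasing coloured = ¬mono (c , record
    { embed = f ; increasing = increasing ; edges = λ {u} {v} uv → distinct uv , coloured uv })
    where
    distinct : ∀ {u v} → Adj H u v → f u ≢ f v
    distinct {u} {v} uv fu≡fv with F.<-cmp u v
    ... | B.tri< u<v _ _ = F.<⇒≢ (increasing u<v) fu≡fv
    ... | B.tri≈ _ u≡v _ = irrefl H u≡v uv
    ... | B.tri> _ _ v<u = F.<⇒≢ (increasing v<u) (sym fu≡fv)

  module Hosts {b W} {Sparse : List (Fin N) → List (Fin N) → Set} (sorted : Sorted W)
               (family : Family K (n * b) Sparse W) where
    open Family family

    -- Vertices of H with the same value of `p` share a part. Cutting it into n blocks, one for each
    -- vertex number, makes every choice of places increasing.
    host : Fin n → List (Fin N)
    host v = block b (toℕ v) (part (p v))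

    host-⊆ : ∀ v → host v ⊆ part (p v)
    host-⊆ v = block-⊆ b (toℕ v) (part (p v))

    host-⊆W : ∀ v → host v ⊆ W
    host-⊆W v = ⊆-trans (host-⊆ v) (part-⊆ (p<K v))

    length-host : ∀ v → length (host v) ≡ b
    length-host v = length-block b (toℕ v)
      (≤-trans (*-monoˡ-≤ b (F.toℕ<n v)) (≤-reflexive (sym (part-size (p<K v)))))

    host-≺ : ∀ {u v} → u F.< v → host u ≺ host v
    host-≺ {u} {v} u<v x∈ y∈ with m≤n⇒m<n∨m≡n (p-mono u<v)
    ... | inj₁ pu<pv = part-≺ pu<pv (p<K v) (lookup (host-⊆ u) x∈) (lookup (host-⊆ v) y∈)
    ... | inj₂ pu≡pv = block-increasing (AllPairs-⊆ (part-⊆ (p<K v)) sorted) b u<v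
      (subst (λ i → _ ∈ block b (toℕ u) (part i)) pu≡pv x∈) y∈

    host-sparse : ∀ {u v} → Adj H u v → Sparse (part (p u)) (part (p v))
    host-sparse {u} {v} uv = sparse (p<K u) (p<K v) (p-≢ uv)

  -- Without a monochromatic copy, the greedy embedding of H in colour c must get stuck, and the
  -- sets X and Y where it does are the required pair.
  families⇒pairs : ∀ {S E} c → 0 < S → 0 < E →
    FamiliesIn (old? κ (toℕ c)) (old-sym κ (toℕ c)) K S (n * (n * E) ^ d) →
    PairsIn (old? κ (suc (toℕ c))) (old-sym κ (suc (toℕ c))) (S * (n * ((n * E) ^ d * n))) E
  families⇒pairs {S} {E} c 0<S 0<E families {M} {W} 0<M sorted large =
    conclude (embed-greedily H G? G-sym T C 0<T 0<C a₀ _ vertices host back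
      (λ {w} _ → ≤-reflexive (sym (length-host w))))
    where
    open DegeneracyOrder order
    open +-*-Solver using (solve; _:*_; _:=_)
    j = toℕ c
    -- The n in T makes room for adding up two degrees, old and new, since 2 ≤ n; the n in C
    -- compensates for X being only a share of at least 1 / n; and b allows each vertex d losses of
    -- a factor T.
    T = n * E
    C = n * M
    b = T ^ d * C
    G : B.Rel (Fin N) 0ℓ
    G x y = colour x y ≡ c
    G? : B.Decidable G
    G? x y = colour x y F.≟ c
    G-sym : B.Symmetric G
    G-sym {x} {y} = trans (colour-symm y x)
    0<n : 0 < n
    0<n = <-≤-trans (s≤s z≤n) 2≤n
    0<T : 0 < T
    0<T = *-mono-< 0<n 0<E
    0<C : 0 < C
    0<C = *-mono-< 0<n 0<M
    0<b : 0 < b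
    0<b = *-mono-< (m^n>0 T ⦃ >-nonZero 0<T ⦄ d) 0<C
    0<nb : 0 < n * b
    0<nb = *-mono-< 0<n 0<b
    fits : S * (n * b) ≤ length W
    fits = ≤-trans (≤-reflexive
      (solve 4 (λ S n t M → S :* (n :* (t :* (n :* M))) := S :* (n :* (t :* n)) :* M) refl
        S n (T ^ d) M)) large
    family : Family K (n * b) (LowDegree (old? κ j) (old-sym κ j) (n * T ^ d) (n * b)) W
    family = families 0<nb sorted fits
    open Hosts {b} sorted family
    a₀ : Fin N
    a₀ = proj₁ (∈-nonempty {xs = W} (≤-trans (*-mono-< 0<S 0<nb) fits))

    conclude : Embedded H G? G-sym T C 0<T 0<C a₀ vertices host ⊎
               Stuck H G? G-sym T C 0<T 0<C a₀ (length vertices) host →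
               SparsePair (old? κ (suc j)) (old-sym κ (suc j)) E M W
    conclude (inj₁ embedded) = ⊥-elim (no-copy c place
      (λ u<v → host-≺ u<v (place-∈ (complete ∈⊤)) (place-∈ (complete ∈⊤)))
      (place-G (complete ∈⊤) (complete ∈⊤)))
      where open Embedded embedded
    conclude (inj₂ stuck) = record
      { X⊆      = ⊆-trans X⊆ (host-⊆W v)
      ; Y⊆      = ⊆-trans Y⊆ (host-⊆W w)
      ; X-size  = *-cancelˡ-≤ n ⦃ >-nonZero 0<n ⦄ (≤-trans X-size (*-monoˡ-≤ (length X) vertices≤n))
      ; Y-size  = ≤-trans (m≤n*m M n ⦃ >-nonZero 0<n ⦄)
                    (≤-trans (m≤n*m C T ⦃ >-nonZero 0<T ⦄) Y-size)
      ; ordered = ordered (F.<-cmp v w)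
      ; sparse  = sparse
      }
      where
      open Stuck stuck
      vertices≤n : length vertices ≤ n
      vertices≤n = subst (length vertices ≤_) (∣⊤∣≡n n) (unique-length≤ unique sound)
      ordered : B.Tri (v F.< w) (v ≡ w) (w F.< v) → X ≺ Y ⊎ Y ≺ X
      ordered (B.tri< v<w _ _) = inj₁ (≺-⊆ X⊆ Y⊆ (host-≺ v<w))
      ordered (B.tri≈ _ v≡w _) = contradiction adj (irrefl H v≡w)
      ordered (B.tri> _ _ w<v) = inj₂ (≺-⊆ Y⊆ X⊆ (host-≺ w<v))
      sparse : LowDegree (old? κ (suc j)) (old-sym κ (suc j)) E (length Y) X Y
      -- Both the old degree and the degree in colour c are at most |Y| / T: the former is at most
      -- C, and T * C ≤ |Y|.
      sparse {x} x∈ = *-cancelˡ-≤ n ⦃ >-nonZero 0<n ⦄ (begin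
        n * (count (old? κ (suc j) x) Y * E)   ≤⟨ *-monoʳ-≤ n (*-monoˡ-≤ E new≤) ⟩
        n * ((old + blue) * E)               ≡⟨ solve′ n old blue E ⟩
        T * old + T * blue                   ≤⟨ +-mono-≤ (*-monoʳ-≤ T old≤C) (<⇒≤ (few x∈)) ⟩
        T * C + length Y                     ≤⟨ +-monoˡ-≤ (length Y) Y-size ⟩
        length Y + length Y                  ≡⟨ cong (length Y +_) (+-identityʳ (length Y)) ⟨
        2 * length Y                         ≤⟨ *-monoˡ-≤ (length Y) 2≤n ⟩
        n * length Y                         ∎)
        where
        open ≤-Reasoning
        old = count (old? κ j x) Y
        blue = count (G? x) Y
        solve′ : ∀ n a b E → n * ((a + b) * E) ≡ n * E * a + n * E * b
        solve′ = solve 4 (λ n a b E → n :* ((a :+ b) :* E) := n :* E :* a :+ n :* E :* b) refl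
          where open +-*-Solver
        new≤ : count (old? κ (suc j) x) Y ≤ old + blue
        new≤ = count-⊎ (old? κ j x) (G? x) (old? κ (suc j) x)
          (λ y lt → Sum.map₂ F.toℕ-injective (m≤n⇒m<n∨m≡n (≤-pred lt))) Y
        -- The family bounds the old degree into the whole part containing Y by n * b / (n * T ^ d),
        -- which is C.
        old≤C : old ≤ C
        old≤C = *-cancelʳ-≤ old C (n * T ^ d)
          ⦃ >-nonZero (*-mono-< 0<n (m^n>0 T ⦃ >-nonZero 0<T ⦄ d)) ⦄ (begin
          old * (n * T ^ d)
            ≤⟨ *-monoˡ-≤ (n * T ^ d) (count-⊆ (old? κ j x) (⊆-trans Y⊆ (host-⊆ w))) ⟩
          count (old? κ j x) (part (p w)) * (n * T ^ d)
                             ≤⟨ host-sparse adj (lookup (⊆-trans X⊆ (host-⊆ v)) x∈) ⟩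
          n * (T ^ d * C)    ≡⟨ *-assoc n (T ^ d) C ⟨
          n * T ^ d * C      ≡⟨ *-comm (n * T ^ d) C ⟩
          C * (n * T ^ d)    ∎)
          where open Family family using (part)

  -- As n < E, degrees of at most n / E vanish: only edges of colour c are left between the parts.
  all-but-one : ∀ {S E} c → suc (toℕ c) ≡ q → n < E →
                FamiliesIn (old? κ (toℕ c)) (old-sym κ (toℕ c)) K S E →
                ∀ {W} → Sorted W → S * n ≤ length W → ⊥
  all-but-one {S} {E} c c-last n<E families {W} sorted large = no-copy c f
    (λ {u} {v} u<v → host-≺ u<v (f∈ u) (f∈ v)) coloured
    where
    j = toℕ c
    0<n : 0 < n
    0<n = <-≤-trans (s≤s z≤n) 2≤n
    -- With b = 1 the hosts are single vertices, so the embedding involves no further choice.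
    family : Family K (n * 1) (LowDegree (old? κ j) (old-sym κ j) E (n * 1)) W
    family = families (≤-trans 0<n (≤-reflexive (sym (*-identityʳ n)))) sorted
      (≤-trans (≤-reflexive (cong (S *_) (*-identityʳ n))) large)
    open Family family using (part)
    open Hosts {1} sorted family
    chosen : ∀ v → ∃[ x ] x ∈ host v
    chosen v = ∈-nonempty (≤-reflexive (sym (length-host v)))
    f : Fin n → Fin N
    f = proj₁ ∘ chosen
    f∈ : ∀ v → f v ∈ host v
    f∈ = proj₂ ∘ chosen
    coloured : ∀ {u v} → Adj H u v → colour (f u) (f v) ≡ c
    coloured {u} {v} uv with old? κ j (f u) (f v)
    ... | yes old = contradiction (begin
      E                                           ≡⟨ *-identityˡ E ⟨
      1 * E
        ≤⟨ *-monoˡ-≤ E (filter-some (old? κ j (f u)) (lose (lookup (host-⊆ v) (f∈ v)) old)) ⟩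
      count (old? κ j (f u)) (part (p v)) * E       ≤⟨ host-sparse uv (lookup (host-⊆ u) (f∈ u)) ⟩
      n * 1                                       ≡⟨ *-identityʳ n ⟩
      n                                           ∎) (<⇒≱ n<E)
      where open ≤-Reasoning
    ... | no ¬old = F.toℕ-injective (≤-antisym
      (≤-pred (≤-trans (F.toℕ<n (colour (f u) (f v))) (≤-reflexive (sym c-last)))) (≮⇒≥ ¬old))

  module _ (L : ℕ) (K≡2^L : K ≡ 2 ^ L) (K≤n² : K ≤ n ^ 2) where

    Families : ℕ → ℕ → Set
    Families j e = FamiliesIn (old? κ j) (old-sym κ j) K (n ^ familyExponent d L j e) (n ^ e)

    0<n : 0 < n
    0<n = <-≤-trans (s≤s z≤n) 2≤n

    0<n^ : ∀ e → 0 < n ^ e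
    0<n^ e = m^n>0 n ⦃ >-nonZero 0<n ⦄ e

    -- No colour is less than 0, so consecutive blocks will do, and K ≤ n ^ 2 accounts for the
    -- exponent 2.
    families-zero : ∀ e → Families 0 e
    families-zero e {M} _ sorted large = blocks sorted (≤-trans (*-monoˡ-≤ M K≤n²) large)
      λ X Y {x} _ → subst (λ ys → length ys * n ^ e ≤ M)
        (sym (filter-none (old? κ 0 x) {Y} (All.universal (λ _ ()) Y))) z≤n

    families-suc : ∀ c → (∀ e → Families (toℕ c) e) → ∀ e → Families (suc (toℕ c)) e
    families-suc c families e {M} 0<M sorted large = subst (λ k → Family k M _ _) (sym K≡2^L)
      (pairs⇒families (old? κ (suc j)) (old-sym κ (suc j)) {P} L 0<P pairs 0<M sorted
        (≤-trans (*-monoˡ-≤ M loss) large))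
      where
      open ≤-Reasoning
      open +-*-Solver using (solve; _:*_; _:=_)
      j = toℕ c
      -- The factor 4 * K ^ 2 lost in splitting is at most n ^ 6, which turns e into 6 + e. The n in
      -- T gives 7 + e, and T ^ d gives the factor d.
      e′ = (7 + e) * d
      a = familyExponent d L j (1 + e′)
      T = n * n ^ (6 + e)
      P = n ^ a * (n * (T ^ d * n))
      T^d≡ : T ^ d ≡ n ^ e′
      T^d≡ = ^-*-assoc n (7 + e) d
      P≡ : P ≡ n ^ (2 + e′ + a)
      P≡ = begin-equality
        n ^ a * (n * (T ^ d * n))    ≡⟨ cong (λ t → n ^ a * (n * (t * n))) T^d≡ ⟩
        n ^ a * (n * (n ^ e′ * n))
          ≡⟨ solve 3 (λ n s t → s :* (n :* (t :* n)) := n :* (n :* (t :* s))) refl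
              n (n ^ a) (n ^ e′) ⟩
        n * (n * (n ^ e′ * n ^ a))   ≡⟨ cong (λ t → n * (n * t)) (^-distribˡ-+-* n e′ a) ⟨
        n ^ (2 + e′ + a)             ∎
      0<P : 0 < P
      0<P = subst (0 <_) (sym P≡) (0<n^ (2 + e′ + a))
      2≤n² : 2 * 2 ≤ n ^ 2
      2≤n² = ≤-trans (*-mono-≤ 2≤n 2≤n) (≤-reflexive (cong (n *_) (sym (*-identityʳ n))))
      scale : 2 ^ L * (4 * 2 ^ L * n ^ e) ≤ n ^ (6 + e)
      scale = begin
        2 ^ L * (4 * 2 ^ L * n ^ e)         ≡⟨ cong (λ k → k * (4 * k * n ^ e)) K≡2^L ⟨
        K * (4 * K * n ^ e)
          ≤⟨ *-mono-≤ K≤n² (*-monoˡ-≤ (n ^ e) (*-mono-≤ 2≤n² K≤n²)) ⟩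
        n ^ 2 * (n ^ 2 * n ^ 2 * n ^ e)
          ≡⟨ cong (λ t → n ^ 2 * (t * n ^ e)) (^-distribˡ-+-* n 2 2) ⟨
        n ^ 2 * (n ^ 4 * n ^ e)             ≡⟨ cong (n ^ 2 *_) (^-distribˡ-+-* n 4 e) ⟨
        n ^ 2 * n ^ (4 + e)                 ≡⟨ ^-distribˡ-+-* n 2 (4 + e) ⟨
        n ^ (6 + e)                         ∎
      pairs : PairsIn (old? κ (suc j)) (old-sym κ (suc j)) P (2 ^ L * (4 * 2 ^ L * n ^ e))
      pairs 0<M′ sorted′ large′ = weaken (families⇒pairs {n ^ a} {n ^ (6 + e)} c
        (0<n^ a) (0<n^ (6 + e))
        (subst (FamiliesIn (old? κ j) (old-sym κ j) K (n ^ a)) (sym (cong (n *_) T^d≡))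
          (families (1 + e′)))
        0<M′ sorted′ large′)
        where
        weaken : ∀ {M W} → SparsePair (old? κ (suc j)) (old-sym κ (suc j)) (n ^ (6 + e)) M W →
                 SparsePair (old? κ (suc j)) (old-sym κ (suc j)) (2 ^ L * (4 * 2 ^ L * n ^ e)) M W
        weaken pair = record
          { X⊆ = X⊆ ; Y⊆ = Y⊆ ; X-size = X-size ; Y-size = Y-size ; ordered = ordered
          ; sparse = λ {x} x∈ → ≤-trans (*-monoʳ-≤ (count (old? κ (suc j) x) Y) scale) (sparse x∈) }
          where open SparsePair pair
      -- Each factor 2 is rounded up to n, whence the 3 and the final 1 in `familyExponent`.
      loss : (2 * P) ^ L * 2 ≤ n ^ familyExponent d L (suc j) e
      loss = begin
        (2 * P) ^ L * 2
          ≤⟨ *-mono-≤ (^-monoˡ-≤ L (*-mono-≤ 2≤n (≤-reflexive P≡))) 2≤n ⟩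
        (n ^ (3 + e′ + a)) ^ L * n
          ≡⟨ cong₂ _*_ (^-*-assoc n (3 + e′ + a) L) (sym (*-identityʳ n)) ⟩
        n ^ ((3 + e′ + a) * L) * n ^ 1      ≡⟨ ^-distribˡ-+-* n ((3 + e′ + a) * L) 1 ⟨
        n ^ familyExponent d L (suc j) e    ∎

    families : ∀ j → j < q → ∀ e → Families j e
    families zero    _   = families-zero
    families (suc j) 1+j<q = subst (λ i → ∀ e → Families (suc i) e) (F.toℕ-fromℕ< j<q)
      (families-suc (F.fromℕ< j<q)
        (subst (λ i → ∀ e → Families i e) (sym (F.toℕ-fromℕ< j<q)) (families j j<q)))
      where
      j<q : j < q
      j<q = <⇒≤ 1+j<q

-- Growth of the exponent

^-distribʳ-* : ∀ k m n → (m * n) ^ k ≡ m ^ k * n ^ k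
^-distribʳ-* zero    m n = refl
^-distribʳ-* (suc k) m n = trans (cong (m * n *_) (^-distribʳ-* k m n))
  ([m*n]*[o*p]≡[m*o]*[n*p] m n (m ^ k) (n ^ k))

-- The summand 2 * (15 + e) strengthens the induction so that the additive terms of the recursion
-- are absorbed. Here 15 is the least c for which passing from e to 1 + (7 + e) * d multiplies c + e
-- by at most d, for every d ≥ 2.
familyExponent-bound : ∀ {d L} → 2 ≤ d → 1 ≤ L → ∀ j e →
                       familyExponent d L j e + 2 * (15 + e) ≤ 3 * (d * L) ^ j * (15 + e)
familyExponent-bound 2≤d 1≤L zero e = begin
  2 + 2 * (15 + e)        ≤⟨ +-monoˡ-≤ (2 * (15 + e)) (m≤m+n 2 (13 + e)) ⟩
  3 * (15 + e)            ∎
  where open ≤-Reasoning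
familyExponent-bound {d} {L} 2≤d 1≤L (suc j) e = begin
  (3 + e′ + a) * L + 1 + 2 * (15 + e)
    ≤⟨ ≤-trans (≤-reflexive (+-assoc ((3 + e′ + a) * L) 1 _)) (+-monoʳ-≤ ((3 + e′ + a) * L) slack) ⟩
  (3 + e′ + a) * L + (29 + e′) * L
    ≡⟨ solve 3 (λ e′ a L → (con 3 :+ e′ :+ a) :* L :+ (con 29 :+ e′) :* L
                          := (a :+ con 2 :* (con 16 :+ e′)) :* L) refl e′ a L ⟩
  (a + 2 * (15 + (1 + e′))) * L
    ≤⟨ *-monoˡ-≤ L (familyExponent-bound 2≤d 1≤L j (1 + e′)) ⟩
  3 * y * (16 + e′) * L                      ≤⟨ *-monoˡ-≤ L (*-monoʳ-≤ (3 * y) grow) ⟩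
  3 * y * (d * (15 + e)) * L
    ≡⟨ solve 4 (λ y d L f → con 3 :* y :* (d :* f) :* L := con 3 :* (d :* L :* y) :* f) refl
        y d L (15 + e) ⟩
  3 * (d * L) ^ suc j * (15 + e)             ∎
  where
  open ≤-Reasoning
  open +-*-Solver
  e′ = (7 + e) * d
  a = familyExponent d L j (1 + e′)
  y = (d * L) ^ j
  grow : 16 + e′ ≤ d * (15 + e)
  grow = begin
    16 + e′           ≤⟨ +-monoˡ-≤ e′ (*-monoʳ-≤ 8 2≤d) ⟩
    8 * d + e′
      ≡⟨ solve 2 (λ d e → con 8 :* d :+ (con 7 :+ e) :* d := d :* (con 15 :+ e)) refl d e ⟩
    d * (15 + e)      ∎
  slack : 1 + 2 * (15 + e) ≤ (29 + e′) * L
  slack = begin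
    1 + 2 * (15 + e)
      ≡⟨ solve 1 (λ e → con 1 :+ con 2 :* (con 15 :+ e) := con 17 :+ (con 7 :+ e) :* con 2) refl e ⟩
    17 + (7 + e) * 2         ≤⟨ +-mono-≤ (m≤m+n 17 12) (*-monoʳ-≤ (7 + e) 2≤d) ⟩
    29 + e′                  ≡⟨ *-identityʳ (29 + e′) ⟨
    (29 + e′) * 1            ≤⟨ *-monoʳ-≤ (29 + e′) 1≤L ⟩
    (29 + e′) * L            ∎

-- Rounding up to a power of two

module _ {m : ℕ} (3≤m : 3 ≤ m) where

  private
    halves : ⌊ m /2⌋ + ⌈ m /2⌉ ≡ m
    halves = ⌊n/2⌋+⌈n/2⌉≡n m

  ⌈m/2⌉<m : ⌈ m /2⌉ < m
  ⌈m/2⌉<m = subst (⌈ m /2⌉ <_) halves (m<n+m ⌈ m /2⌉ (⌊n/2⌋-mono 3≤m))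

  m≤2⌈m/2⌉ : m ≤ 2 * ⌈ m /2⌉
  m≤2⌈m/2⌉ = begin
    m                          ≡⟨ halves ⟨
    ⌊ m /2⌋ + ⌈ m /2⌉          ≤⟨ +-monoˡ-≤ ⌈ m /2⌉ (⌊n/2⌋≤⌈n/2⌉ m) ⟩
    ⌈ m /2⌉ + ⌈ m /2⌉          ≡⟨ cong (⌈ m /2⌉ +_) (+-identityʳ ⌈ m /2⌉) ⟨
    2 * ⌈ m /2⌉                ∎
    where open ≤-Reasoning

  2⌈m/2⌉≤1+m : 2 * ⌈ m /2⌉ ≤ suc m
  2⌈m/2⌉≤1+m = begin
    2 * ⌈ m /2⌉                    ≡⟨ cong (⌈ m /2⌉ +_) (+-identityʳ ⌈ m /2⌉) ⟩
    ⌊ suc m /2⌋ + ⌊ suc m /2⌋      ≤⟨ +-monoʳ-≤ ⌊ suc m /2⌋ (⌊n/2⌋≤⌈n/2⌉ (suc m)) ⟩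
    ⌊ suc m /2⌋ + ⌈ suc m /2⌉      ≡⟨ ⌊n/2⌋+⌈n/2⌉≡n (suc m) ⟩
    suc m                          ∎
    where open ≤-Reasoning

  2≤⌈m/2⌉ : 2 ≤ ⌈ m /2⌉
  2≤⌈m/2⌉ = ⌈n/2⌉-mono 3≤m

  ⌈log₂⌉-step : ⌈log₂ m ⌉ ≡ suc ⌈log₂ ⌈ m /2⌉ ⌉
  ⌈log₂⌉-step = sym (trans (cong suc (⌈log₂⌈n/2⌉⌉≡⌈log₂n⌉∸1 m))
    (suc-pred ⌈log₂ m ⌉ ⦃ >-nonZero (⌈log₂⌉-mono-≤ {2} (<⇒≤ 3≤m)) ⦄))

-- Induction by halving. The 2 added in the upper bound absorbs the rounding: doubling the bound for
-- ⌈ m /2⌉ gives at most 4 * ⌈ m /2⌉ ≤ 2 * m + 2 on the right, but 4 extra on the left.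
2^⌈log₂⌉-bounds : ∀ m → 2 ≤ m → m ≤ 2 ^ ⌈log₂ m ⌉ × 2 ^ ⌈log₂ m ⌉ + 2 ≤ 2 * m
2^⌈log₂⌉-bounds = <-rec _ step
  where
  open ≤-Reasoning
  Bounds : ℕ → Set
  Bounds m = 2 ≤ m → m ≤ 2 ^ ⌈log₂ m ⌉ × 2 ^ ⌈log₂ m ⌉ + 2 ≤ 2 * m
  step : ∀ m → (∀ {k} → k < m → Bounds k) → Bounds m
  step m rec 2≤m with m≤n⇒m<n∨m≡n 2≤m
  ... | inj₂ refl = ≤-refl , ≤-refl
  ... | inj₁ 3≤m =
    let lower , upper = rec (⌈m/2⌉<m 3≤m) (2≤⌈m/2⌉ 3≤m)
        c = ⌈ m /2⌉
        l = ⌈log₂ ⌈ m /2⌉ ⌉ in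
    (begin
      m                ≤⟨ m≤2⌈m/2⌉ 3≤m ⟩
      2 * c            ≤⟨ *-monoʳ-≤ 2 lower ⟩
      2 ^ suc l        ≡⟨ cong (2 ^_) (⌈log₂⌉-step 3≤m) ⟨
      2 ^ ⌈log₂ m ⌉    ∎) ,
    +-cancelʳ-≤ 2 _ _ (begin
      2 ^ ⌈log₂ m ⌉ + 2 + 2   ≡⟨ cong (λ k → 2 ^ k + 2 + 2) (⌈log₂⌉-step 3≤m) ⟩
      2 * 2 ^ l + 2 + 2       ≡⟨ trans (+-assoc (2 * 2 ^ l) 2 2) (sym (*-distribˡ-+ 2 (2 ^ l) 2)) ⟩
      2 * (2 ^ l + 2)         ≤⟨ *-monoʳ-≤ 2 upper ⟩
      2 * (2 * c)             ≤⟨ *-monoʳ-≤ 2 (2⌈m/2⌉≤1+m 3≤m) ⟩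
      2 * suc m               ≡⟨ *-suc 2 m ⟩
      2 + 2 * m               ≡⟨ +-comm 2 (2 * m) ⟩
      2 * m + 2               ∎)

-- Number of parts and the bound for the Ramsey number

module _ {n k} {H : OrderedGraph n} (colouring : IntervalColouring H k) where
  open IntervalColouring colouring

  parts≤vertices : k ≤ n
  parts≤vertices = F.injective⇒≤ {f = proj₁ ∘ nonempty} λ {c} {c′} eq →
    trans (sym (proj₂ (nonempty c))) (trans (cong part eq) (proj₂ (nonempty c′)))

  2≤parts : HasEdge H → 2 ≤ k
  2≤parts (u , v , uv) = distinct⇒2≤ (part u) (part v) (independent uv)
    where
    distinct⇒2≤ : ∀ {k} (a b : Fin k) → a ≢ b → 2 ≤ k
    distinct⇒2≤ {suc zero}    F.zero F.zero a≢b = contradiction refl a≢b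
    distinct⇒2≤ {suc (suc k)} _      _      _   = s≤s (s≤s z≤n)

corollary4 : ∀ (d q : ℕ) → 2 ≤ d → 2 ≤ q →
    ∀ (n : ℕ) → 3 ≤ n → ∀ (H : OrderedGraph n) → Degenerate d H → HasEdge H →
    ∀ (χ : ℕ) → IsIntervalChromaticNumber H χ →
    ∃[ r ] (IsOrderedRamseyNumber H q r ×
    r ≤ n ^ (60 * d ^ (q ∸ 1) * ⌈log₂ χ ⌉ ^ (q ∸ 1)))
corollary4 d (suc q) 2≤d 2≤q n 3≤n H degenerate edge χ (colouring , _) =
  least (arrows? H (suc q)) N arrows
  where
  open ≤-Reasoning
  L = ⌈log₂ χ ⌉
  X = 60 * d ^ q * L ^ q
  N = n ^ X

  2≤n : 2 ≤ n
  2≤n = <⇒≤ 3≤n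

  2≤χ : 2 ≤ χ
  2≤χ = 2≤parts colouring edge

  1≤L : 1 ≤ L
  1≤L = ⌈log₂⌉-mono-≤ {2} 2≤χ

  -- Rounding χ up to a power of two less than doubles it, and χ ≤ n.
  2^L≤n² : 2 ^ L ≤ n ^ 2
  2^L≤n² = begin
    2 ^ L        ≤⟨ m+n≤o⇒m≤o (2 ^ L) (proj₂ (2^⌈log₂⌉-bounds χ 2≤χ)) ⟩
    2 * χ        ≤⟨ *-mono-≤ 2≤n (parts≤vertices colouring) ⟩
    n * n        ≡⟨ cong (n *_) (*-identityʳ n) ⟨
    n ^ 2        ∎

  n<n² : n < n ^ 2
  n<n² = <-≤-trans (m<m*n n n ⦃ >-nonZero (<⇒≤ 2≤n) ⦄ 2≤n)
    (≤-reflexive (cong (n *_) (sym (*-identityʳ n))))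

  order : DegeneracyOrder H d ⊤
  order = degeneracyOrder H degenerate n ⊤ (≤-reflexive (∣⊤∣≡n n))

  -- The last colour requires n < n ^ e, so e = 2. Then 3 * (15 + e) = 51 is below 60, and the 1 in
  -- a + 1 pays for parts of n vertices.
  a = familyExponent d L q 2
  exponent≤ : a + 1 ≤ X
  exponent≤ = begin
    a + 1                    ≤⟨ +-monoʳ-≤ a (m≤m+n 1 33) ⟩
    a + 34                   ≤⟨ familyExponent-bound 2≤d 1≤L q 2 ⟩
    3 * (d * L) ^ q * 17
      ≡⟨ solve 1 (λ y → con 3 :* y :* con 17 := con 51 :* y) refl ((d * L) ^ q) ⟩
    51 * (d * L) ^ q         ≤⟨ *-monoˡ-≤ ((d * L) ^ q) (m≤m+n 51 9) ⟩
    60 * (d * L) ^ q         ≡⟨ cong (60 *_) (^-distribʳ-* q d L) ⟩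
    60 * (d ^ q * L ^ q)     ≡⟨ *-assoc 60 (d ^ q) (L ^ q) ⟨
    X                        ∎
    where open +-*-Solver using (solve; con; _:*_; _:=_)

  large : n ^ a * n ≤ length (allFin N)
  large = begin
    n ^ a * n              ≡⟨ *-comm (n ^ a) n ⟩
    n ^ suc a              ≡⟨ cong (n ^_) (+-comm 1 a) ⟩
    n ^ (a + 1)            ≤⟨ ^-monoʳ-≤ n ⦃ >-nonZero (<⇒≤ 2≤n) ⦄ exponent≤ ⟩
    N                      ≡⟨ length-tabulate {n = N} (λ i → i) ⟨
    length (allFin N)      ∎

  arrows : Arrows H (suc q) N
  -- Having a monochromatic copy is decidable, so its absence may be assumed. The colours below
  -- `F.fromℕ q` are removed, and this last one carries the contradiction.
  arrows κ = decidable-stable (monochromatic? H κ) λ ¬mono →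
    let open MonochromaticFree 2≤n order (rank colouring) rank<2^L
               (rank-mono colouring) (rank-≢ colouring) κ ¬mono in
    all-but-one {n ^ a} {n ^ 2} (F.fromℕ q) (cong suc (F.toℕ-fromℕ q)) n<n²
      (subst (λ j → FamiliesIn (old? κ j) (old-sym κ j) (2 ^ L) (n ^ a) (n ^ 2))
        (sym (F.toℕ-fromℕ q))
        (families L refl 2^L≤n² q ≤-refl 2))
      (AllPairs.tabulate⁺-< (λ i<j → i<j)) large
    where
    rank<2^L : ∀ v → rank colouring v < 2 ^ L
    rank<2^L v = <-≤-trans (rank<k colouring v) (proj₁ (2^⌈log₂⌉-bounds χ 2≤χ))
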